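{- There exist a finite abelian group $G_1$, an integer $M\ge1$, and finite non-empty subsets $F_1,\dots,F_M$ of $G=\mathbb{Z}^2\times G_1$ such that the system of tiling equations $A\oplus F_m=G$, $m=1,\dots,M$, is aperiodic.
   Context: For an abelian group $G$ and $A,F\subset G$, $A\oplus F=G$ means that the translates $a+F$, $a\in A$, are pairwise disjoint and their union is $G$. A set $A\subset G$ is periodic if it is a finite union of cosets of a finite-index subgroup of $G$. The system $A\oplus F_m=G$, $m=1,\dots,M$ (unknown $A$) is aperiodic if some $A\subset G$ solves all equations simultaneously, but no such $A$ is periodic. -}

module Defs where

open import Level using (0ℓ)
open import Data.Nat using (ℕ; suc)
open import Data.Fin using (Fin)
open import Data.Integer as ℤ using (ℤ)
open import Data.Product using (Σ; ∃; ∃-syntax; _×_; _,_)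
open import Data.List using (List; _∷_)
open import Data.List.Membership.Propositional using (_∈_)
open import Relation.Binary.PropositionalEquality using (_≡_)
open import Relation.Nullary using (¬_)
open import Function.Bundles using (_↔_)
open import Algebra.Bundles using (AbelianGroup)

record FiniteAbelianGroup : Set₁ where
  field
    abGroup  : AbelianGroup 0ℓ 0ℓ
  open AbelianGroup abGroup public
  field
    ≈⇒≡      : ∀ {x y} → x ≈ y → x ≡ y
    size     : ℕ
    enum     : Carrier ↔ Fin size

module Ambient (G₁ : FiniteAbelianGroup) where
  private module H = FiniteAbelianGroup G₁

  G : Set
  G = ℤ × ℤ × H.Carrier

  infixl 6 _⊕_ _⊖_
  _⊕_ : G → G → G
  (a , b , x) ⊕ (c , d , y) = (a ℤ.+ c , b ℤ.+ d , x H.∙ y)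

  ⊝_ : G → G
  ⊝ (a , b , x) = (ℤ.- a , ℤ.- b , x H.⁻¹)

  _⊖_ : G → G → G
  g ⊖ h = g ⊕ (⊝ h)

  𝟘 : G
  𝟘 = (ℤ.0ℤ , ℤ.0ℤ , H.ε)

  Subset : Set₁
  Subset = G → Set

  Tiles : Subset → List G → Set
  Tiles A F =
    (∀ g → ∃[ a ] ∃[ f ] (A a × f ∈ F × a ⊕ f ≡ g)) ×
    (∀ a a′ f f′ → A a → A a′ → f ∈ F → f′ ∈ F → a ⊕ f ≡ a′ ⊕ f′ → a ≡ a′)

  record Subgroup (H : Subset) : Set where
    field
      zero-mem : H 𝟘
      ⊕-mem    : ∀ {x y} → H x → H y → H (x ⊕ y)
      ⊝-mem    : ∀ {x} → H x → H (⊝ x)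

  FiniteIndex : Subset → Set
  FiniteIndex H = Σ (List G) λ reps → ∀ g → ∃[ r ] (r ∈ reps × H (g ⊖ r))

  Periodic : Subset → Set₁
  Periodic A =
    Σ Subset λ H → Subgroup H × FiniteIndex H ×
      Σ (List G) λ cs → ∀ g → (A g → ∃[ c ] (c ∈ cs × H (g ⊖ c)))
                             × (∀ c → c ∈ cs → H (g ⊖ c) → A g)

  NonEmpty : List G → Set
  NonEmpty F = ∃[ f ] f ∈ F

  Aperiodic : (M : ℕ) → (Fin M → List G) → Set₁
  Aperiodic M F =
    (∃[ A ] ∀ m → Tiles A (F m)) ×
    (∀ A → (∀ m → Tiles A (F m)) → ¬ Periodic A)

{-# OPTIONS --safe #-}

-- Let f x be the last nonzero digit of x in base 8.  The functions f x, f y, f (x + y), f (x + 8 y)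
-- and f (y + 8 x) on ℤ² are constant along a direction and satisfy finitely many rules at each site.
-- Conversely, if functions satisfy these rules and agree with the residue modulo 8 wherever it is
-- nonzero, then their restrictions to the multiples of 8 are, up to shifts, functions of the same
-- kind.  Hence a period would be divisible by 8, and dividing by 8 gives an infinite descent.
--
-- The rules become tilings of ℤ² × Bool² × (ℤ/4)^K by the graph of a function f with values in
-- (ℤ/4)^K.  A tiling equation can say that a coordinate u of f has u X and u (X + t) in some fixed
-- {a , a + 1}, which makes u a Boolean array, and that a linear combination of coordinates is
-- invariant under a translation.  The relation p + q = r + s between Booleans, modulo 4 and up to a
-- constant, suffices to express disjunctions once the constant is fixed on a dummy layer.

module Submission where

open import Defs
open import Algebra.Bundles using (CommutativeRing)
open import Algebra.Structures using (IsAbelianGroup)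
open import Data.Bool using (Bool; true; false; not; _∧_; _∨_; _xor_; if_then_else_)
open import Data.Bool.Properties as Bool using (xor-∧-commutativeRing; xor-comm; xor-assoc; xor-same; xor-identityʳ; xor-annihilates-not; not-involutive)
open import Data.Empty using (⊥-elim)
open import Data.Fin using (Fin; zero; suc; toℕ; fromℕ; fromℕ<; inject₁; combine; remQuot)
open import Data.Fin.Induction using (>-weakInduction)
open import Data.Fin.Patterns
open import Data.Fin.Properties as Fin using (all?; any?; pigeonhole; remQuot-combine; toℕ-fromℕ<; +↔⊎; *↔×)
open import Data.Integer as ℤ using (ℤ; +_; -[1+_]; _+_; _-_; _*_; -_; ∣_∣; _/ℕ_)
open import Data.Integer.DivMod using (n%ℕd<d; a≡a%ℕn+[a/ℕn]*n)
open import Data.Integer.Properties as ℤ using (+-0-abelianGroup)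
open import Data.Integer.Tactic.RingSolver using (solve-∀)
open import Data.List as List using (List; []; _∷_; _++_; length; map; filter; filterᵇ; concatMap; allFin)
open import Data.List.Membership.Propositional using (_∈_)
open import Data.List.Membership.Propositional.Properties using (∈-map⁺; ∈-map⁻; ∈-allFin; ∈-lookup; ∈-++⁺ˡ; ∈-++⁺ʳ; ∈-++⁻; ∈-filter⁺; ∈-filter⁻)
open import Data.List.Relation.Unary.All as All using (All; []; _∷_)
open import Data.List.Relation.Unary.All.Properties using (map⁺; map⁻; ++⁺; ++⁻ˡ; ++⁻ʳ)
open import Data.List.Relation.Unary.Any using (here; there; index)
open import Data.List.Relation.Unary.Any.Properties using (lookup-index)
open import Data.Nat as ℕ using (ℕ; _≥_)
open import Data.Nat.Divisibility as ℕ using ()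
open import Data.Nat.DivMod using (_mod_)
open import Data.Nat.Properties as ℕ using ()
open import Data.Product using (Σ; ∃; _×_; _,_; proj₁; proj₂)
open import Data.Product.Function.NonDependent.Propositional using (_×-↔_)
open import Data.Sum using (_⊎_; inj₁; inj₂; [_,_]′)
open import Data.Sum.Function.Propositional using (_⊎-↔_)
open import Data.Unit using (⊤; tt)
open import Data.Vec as Vec using (Vec; []; _∷_; lookup; replicate; tabulate; zipWith)
open import Data.Vec.Properties using (lookup∘tabulate; lookup-map; lookup-zipWith; tabulate-cong)
open import Function using (_∘_; id)
open import Function.Bundles using (_↔_; Inverse; mk↔ₛ′)
open import Function.Properties.Inverse using (↔-refl; ↔-sym; ↔-trans)
open import Relation.Binary.PropositionalEquality
open import Relation.Nullary using (¬_; Dec; yes; no; does)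
open import Relation.Nullary.Decidable using (from-yes; map′; decidable-stable; ¬?; _→-dec_; _×-dec_; _⊎-dec_)
open import Algebra.Properties.AbelianGroup +-0-abelianGroup using (∙-cancelˡ)

-- Arithmetic modulo 4

-- Tiling equations are blind to translations of `A`, so they see only differences of values of the
-- function: no coordinate knows its origin, and no Boolean can be told from its negation. The sign
-- flip makes this a symmetry. Every Boolean array becomes its negation under `tᴰ`, so a constant
-- value C of p + q - r - s satisfies C = - C, and C is 0 or 2. If one of p, q agrees with one of r,
-- s at some point, the balance there is -1, 0 or 1, and C is 0. As p + q - r - s lies between -2
-- and 2, the relation modulo 4 then holds in the integers. On the dummy layer the chain variables
-- are forced to be true, which supplies such points while leaving the real layer free. The base is
-- 8 because the rigidity argument picks a residue class outside four given ones, which takes five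
-- classes, and because a power of two lets Booleans encode a digit exactly.

infixl 6 _⊞_ _⊟_

opaque
  _⊞_ : Fin 4 → Fin 4 → Fin 4
  x ⊞ y = (toℕ x ℕ.+ toℕ y) mod 4

  neg : Fin 4 → Fin 4
  neg x = (4 ℕ.∸ toℕ x) mod 4

  _⊟_ : Fin 4 → Fin 4 → Fin 4
  x ⊟ y = x ⊞ neg y

opaque
  unfolding _⊞_ neg

  ⊞-assoc : ∀ x y z → (x ⊞ y) ⊞ z ≡ x ⊞ (y ⊞ z)
  ⊞-assoc = from-yes (all? λ x → all? λ y → all? λ z → (x ⊞ y) ⊞ z Fin.≟ x ⊞ (y ⊞ z))

  ⊞-comm : ∀ x y → x ⊞ y ≡ y ⊞ x
  ⊞-comm = from-yes (all? λ x → all? λ y → x ⊞ y Fin.≟ y ⊞ x)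

  ⊞-identityˡ : ∀ x → zero ⊞ x ≡ x
  ⊞-identityˡ = from-yes (all? λ x → zero ⊞ x Fin.≟ x)

  ⊞-inverseˡ : ∀ x → neg x ⊞ x ≡ zero
  ⊞-inverseˡ = from-yes (all? λ x → neg x ⊞ x Fin.≟ zero)

-- Finite abelian groups: products and powers

isAbelianGroup : {A : Set} (_∙_ : A → A → A) (ε : A) (inv : A → A) →
  (∀ x y z → (x ∙ y) ∙ z ≡ x ∙ (y ∙ z)) → (∀ x y → x ∙ y ≡ y ∙ x) →
  (∀ x → ε ∙ x ≡ x) → (∀ x → inv x ∙ x ≡ ε) → IsAbelianGroup _≡_ _∙_ ε inv
isAbelianGroup _∙_ ε inv assoc comm idˡ invˡ = record
  { isGroup = record
    { isMonoid = record
      { isSemigroup = record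
        { isMagma = record { isEquivalence = isEquivalence ; ∙-cong = cong₂ _∙_ }
        ; assoc = assoc }
      ; identity = idˡ , λ x → trans (comm x ε) (idˡ x) }
    ; inverse = invˡ , λ x → trans (comm x (inv x)) (invˡ x)
    ; ⁻¹-cong = cong inv }
  ; comm = comm }

module Laws (H : FiniteAbelianGroup) where
  open FiniteAbelianGroup H public using (Carrier; _∙_; ε; _⁻¹; size; enum)
  private module H = FiniteAbelianGroup H

  ∙-assoc : ∀ x y z → (x ∙ y) ∙ z ≡ x ∙ (y ∙ z)
  ∙-assoc x y z = H.≈⇒≡ (H.assoc x y z)

  ∙-comm : ∀ x y → x ∙ y ≡ y ∙ x
  ∙-comm x y = H.≈⇒≡ (H.comm x y)

  ∙-identityˡ : ∀ x → ε ∙ x ≡ x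
  ∙-identityˡ x = H.≈⇒≡ (H.identityˡ x)

  ∙-inverseˡ : ∀ x → (x ⁻¹) ∙ x ≡ ε
  ∙-inverseˡ x = H.≈⇒≡ (H.inverseˡ x)

  elements : List Carrier
  elements = map (Inverse.from enum) (allFin size)

  ∈-elements : ∀ x → x ∈ elements
  ∈-elements x = subst (_∈ elements) (Inverse.strictlyInverseʳ enum x)
    (∈-map⁺ (Inverse.from enum) (∈-allFin (Inverse.to enum x)))

  ∙-conjugate : ∀ x y → (x ∙ y) ∙ (x ⁻¹) ≡ y
  ∙-conjugate x y = trans (∙-comm (x ∙ y) (x ⁻¹)) (trans (sym (∙-assoc (x ⁻¹) x y))
    (trans (cong (_∙ y) (∙-inverseˡ x)) (∙-identityˡ y)))

  ∙-inverseʳ : ∀ x → x ∙ (x ⁻¹) ≡ ε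
  ∙-inverseʳ x = trans (∙-comm x (x ⁻¹)) (∙-inverseˡ x)

Boolᴳ : FiniteAbelianGroup
Boolᴳ = record
  { abGroup = CommutativeRing.+-abelianGroup xor-∧-commutativeRing
  ; ≈⇒≡ = id
  ; size = 2
  ; enum = mk↔ₛ′ (λ { false → zero ; true → suc zero }) (λ { zero → false ; (suc zero) → true })
      (λ { zero → refl ; (suc zero) → refl }) (λ { false → refl ; true → refl }) }

Fin4ᴳ : FiniteAbelianGroup
Fin4ᴳ = record
  { abGroup = record { isAbelianGroup = isAbelianGroup _⊞_ zero neg ⊞-assoc ⊞-comm ⊞-identityˡ ⊞-inverseˡ }
  ; ≈⇒≡ = id
  ; size = 4
  ; enum = ↔-refl }

infixr 5 _×ᴳ_

_×ᴳ_ : FiniteAbelianGroup → FiniteAbelianGroup → FiniteAbelianGroup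
H ×ᴳ K = record
  { abGroup = record { isAbelianGroup = isAbelianGroup
      (λ { (a , b) (c , d) → (a H.∙ c , b K.∙ d) }) (H.ε , K.ε) (λ { (a , b) → (a H.⁻¹ , b K.⁻¹) })
      (λ { (a , b) (c , d) (e , f) → cong₂ _,_ (H.∙-assoc a c e) (K.∙-assoc b d f) })
      (λ { (a , b) (c , d) → cong₂ _,_ (H.∙-comm a c) (K.∙-comm b d) })
      (λ { (a , b) → cong₂ _,_ (H.∙-identityˡ a) (K.∙-identityˡ b) })
      (λ { (a , b) → cong₂ _,_ (H.∙-inverseˡ a) (K.∙-inverseˡ b) }) }
  ; ≈⇒≡ = id
  ; size = H.size ℕ.* K.size
  ; enum = ↔-trans (H.enum ×-↔ K.enum) (↔-sym Fin.*↔×) }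
  where
  module H = Laws H
  module K = Laws K

module _ (H : FiniteAbelianGroup) where
  private module H = Laws H

  zipWith-laws : ∀ n → IsAbelianGroup _≡_ (zipWith {n = n} H._∙_) (replicate n H.ε) (Vec.map H._⁻¹)
  zipWith-laws n = isAbelianGroup _ _ _ assoc comm idˡ invˡ
    where
    assoc : ∀ {n} (x y z : Vec H.Carrier n) → zipWith H._∙_ (zipWith H._∙_ x y) z ≡ zipWith H._∙_ x (zipWith H._∙_ y z)
    assoc [] [] [] = refl
    assoc (a ∷ x) (b ∷ y) (c ∷ z) = cong₂ _∷_ (H.∙-assoc a b c) (assoc x y z)
    comm : ∀ {n} (x y : Vec H.Carrier n) → zipWith H._∙_ x y ≡ zipWith H._∙_ y x
    comm [] [] = refl
    comm (a ∷ x) (b ∷ y) = cong₂ _∷_ (H.∙-comm a b) (comm x y)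
    idˡ : ∀ {n} (x : Vec H.Carrier n) → zipWith H._∙_ (replicate n H.ε) x ≡ x
    idˡ [] = refl
    idˡ (a ∷ x) = cong₂ _∷_ (H.∙-identityˡ a) (idˡ x)
    invˡ : ∀ {n} (x : Vec H.Carrier n) → zipWith H._∙_ (Vec.map H._⁻¹ x) x ≡ replicate n H.ε
    invˡ [] = refl
    invˡ (a ∷ x) = cong₂ _∷_ (H.∙-inverseˡ a) (invˡ x)

  Vec-enum : ∀ n → Vec H.Carrier n ↔ Fin (H.size ℕ.^ n)
  Vec-enum ℕ.zero = mk↔ₛ′ (λ _ → zero) (λ _ → []) (λ { zero → refl ; (suc ()) }) (λ { [] → refl })
  Vec-enum (ℕ.suc n) = ↔-trans uncons (↔-trans (H.enum ×-↔ Vec-enum n) (↔-sym Fin.*↔×))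
    where
    uncons : Vec H.Carrier (ℕ.suc n) ↔ (H.Carrier × Vec H.Carrier n)
    uncons = mk↔ₛ′ (λ { (x ∷ v) → x , v }) (λ { (x , v) → x ∷ v }) (λ _ → refl) (λ { (x ∷ v) → refl })

  Vecᴳ : ℕ → FiniteAbelianGroup
  Vecᴳ n = record
    { abGroup = record { isAbelianGroup = zipWith-laws n }
    ; ≈⇒≡ = id
    ; size = H.size ℕ.^ n
    ; enum = Vec-enum n }

-- Tilings by the graph of a function

-- The index group ℤ² × Bool²: the first Boolean is the sign flip t, the second the layer s.
D : Set
D = ℤ × ℤ × Bool × Bool

infixl 6 _+ᴰ_ _-ᴰ_

_+ᴰ_ : D → D → D
(a , b , t , s) +ᴰ (c , d , t′ , s′) = (a ℤ.+ c , b ℤ.+ d , t xor t′ , s xor s′)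

_-ᴰ_ : D → D → D
(a , b , t , s) -ᴰ (c , d , t′ , s′) = (a ℤ.- c , b ℤ.- d , t xor t′ , s xor s′)

0ᴰ : D
0ᴰ = (ℤ.0ℤ , ℤ.0ℤ , false , false)

xor-cancel : ∀ a b → (a xor b) xor b ≡ a
xor-cancel a b = trans (xor-assoc a b b) (trans (cong (a xor_) (xor-same b)) (xor-identityʳ a))

ℤ-cancel : ∀ a b → (a ℤ.- b) ℤ.+ b ≡ a
ℤ-cancel a b = trans (ℤ.+-assoc a (ℤ.- b) b) (trans (cong (λ z → a ℤ.+ z) (ℤ.+-inverseˡ b)) (ℤ.+-identityʳ a))

ℤ-cancel′ : ∀ a b → (a ℤ.+ b) ℤ.- b ≡ a
ℤ-cancel′ a b = trans (ℤ.+-assoc a b (ℤ.- b)) (trans (cong (λ z → a ℤ.+ z) (ℤ.+-inverseʳ b)) (ℤ.+-identityʳ a))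

D-ext : ∀ {a a′ b b′ t t′ s s′} → a ≡ a′ → b ≡ b′ → t ≡ t′ → s ≡ s′ → _≡_ {A = D} (a , b , t , s) (a′ , b′ , t′ , s′)
D-ext refl refl refl refl = refl

-+ᴰ : ∀ X h → (X -ᴰ h) +ᴰ h ≡ X
-+ᴰ (a , b , t , s) (c , d , t′ , s′) = D-ext (ℤ-cancel a c) (ℤ-cancel b d) (xor-cancel t t′) (xor-cancel s s′)

+-ᴰ : ∀ X h → (X +ᴰ h) -ᴰ h ≡ X
+-ᴰ (a , b , t , s) (c , d , t′ , s′) = D-ext (ℤ-cancel′ a c) (ℤ-cancel′ b d) (xor-cancel t t′) (xor-cancel s s′)

-ᴰ-0ᴰ : ∀ X → X -ᴰ 0ᴰ ≡ X
-ᴰ-0ᴰ (a , b , t , s) = D-ext (ℤ.+-identityʳ a) (ℤ.+-identityʳ b) (xor-identityʳ t) (xor-identityʳ s)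

module Graphs (R : FiniteAbelianGroup) where
  private module R = Laws R

  Gᴿ : FiniteAbelianGroup
  Gᴿ = Boolᴳ ×ᴳ Boolᴳ ×ᴳ R

  open Ambient Gᴿ public

  pt : D → R.Carrier → G
  pt (a , b , t , s) y = (a , b , t , s , y)

  pt-injective : ∀ X Y {x y} → pt X x ≡ pt Y y → X ≡ Y × x ≡ y
  pt-injective _ _ refl = refl , refl

  place : G → D
  place (a , b , t , s , _) = (a , b , t , s)

  value : G → R.Carrier
  value (_ , _ , _ , _ , y) = y

  Piece : Set
  Piece = D × (R.Carrier → Bool)

  piece : Piece → List G
  piece (h , E) = map (pt h) (filterᵇ E R.elements)

  tile : List Piece → List G
  tile = concatMap piece

  private
    ∈-filterᵇ⁺ : ∀ (E : R.Carrier → Bool) {x} xs → x ∈ xs → E x ≡ true → x ∈ filterᵇ E xs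
    ∈-filterᵇ⁺ E (y ∷ xs) (here refl) e rewrite e = here refl
    ∈-filterᵇ⁺ E (y ∷ xs) (there p) e with E y
    ... | true  = there (∈-filterᵇ⁺ E xs p e)
    ... | false = ∈-filterᵇ⁺ E xs p e

    ∈-filterᵇ⁻ : ∀ (E : R.Carrier → Bool) {x} xs → x ∈ filterᵇ E xs → E x ≡ true
    ∈-filterᵇ⁻ E (y ∷ xs) p with E y in eq
    ∈-filterᵇ⁻ E (y ∷ xs) (here refl) | true = eq
    ∈-filterᵇ⁻ E (y ∷ xs) (there p)   | true = ∈-filterᵇ⁻ E xs p
    ∈-filterᵇ⁻ E (y ∷ xs) p           | false = ∈-filterᵇ⁻ E xs p

  ∈-tile⁺ : ∀ {h E} P {y} → (h , E) ∈ P → E y ≡ true → pt h y ∈ tile P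
  ∈-tile⁺ {h} {E} (p ∷ P) {y} (here refl) e =
    ∈-++⁺ˡ (∈-map⁺ (pt h) (∈-filterᵇ⁺ E R.elements (R.∈-elements y) e))
  ∈-tile⁺ (p ∷ P) (there q) e = ∈-++⁺ʳ (piece p) (∈-tile⁺ P q e)

  ∈-tile⁻ : ∀ P {g} → g ∈ tile P → ∃ λ h → ∃ λ E → ∃ λ y → (h , E) ∈ P × g ≡ pt h y × E y ≡ true
  ∈-tile⁻ ((h , E) ∷ P) g∈ with ∈-++⁻ (piece (h , E)) g∈
  ... | inj₂ q = let h′ , E′ , y , m , r = ∈-tile⁻ P q in h′ , E′ , y , there m , r
  ... | inj₁ q with ∈-map⁻ (pt h) q
  ... | y , y∈ , refl = h , E , y , here refl , refl , ∈-filterᵇ⁻ E R.elements y∈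

  infix 4 _∋_from_

  _∋_from_ : (R.Carrier → Bool) → R.Carrier → R.Carrier → Set
  E ∋ y from x = E (y R.∙ (x R.⁻¹)) ≡ true

  graph : (D → R.Carrier) → Subset
  graph f g = value g ≡ f (place g)

  -- In the fibre over `X`, the piece at `h` covers the translate of `E` by `f (X -ᴰ h)`, because
  -- the only point of the graph that can reach the fibre with this piece lies over `X -ᴰ h`. The
  -- hypotheses say that these translates partition every fibre.
  Tiles-graph : ∀ f P →
    (∀ X y → ∃ λ h → ∃ λ E → (h , E) ∈ P × E ∋ y from f (X -ᴰ h)) →
    (∀ X y {h E h′ E′} → (h , E) ∈ P → (h′ , E′) ∈ P → E ∋ y from f (X -ᴰ h) → E′ ∋ y from f (X -ᴰ h′) → h ≡ h′) →
    Tiles (graph f) (tile P)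
  Tiles-graph f P cover unique = covers , injective
    where
    covers : ∀ g → ∃ λ a → ∃ λ p → graph f a × p ∈ tile P × a ⊕ p ≡ g
    covers g = let X = place g
                   y = value g
                   h , E , m , e = cover X y
                   z = f (X -ᴰ h)
               in pt (X -ᴰ h) z , pt h (y R.∙ (z R.⁻¹)) , refl , ∈-tile⁺ P m e ,
                  cong₂ pt (-+ᴰ X h) (trans (sym (R.∙-assoc z y (z R.⁻¹))) (R.∙-conjugate z y))
    injective : ∀ a a′ p p′ → graph f a → graph f a′ → p ∈ tile P → p′ ∈ tile P → a ⊕ p ≡ a′ ⊕ p′ → a ≡ a′
    injective a a′ p p′ ga ga′ p∈ p′∈ eq with ∈-tile⁻ P p∈ | ∈-tile⁻ P p′∈
    ... | h , E , y , m , refl , e | h′ , E′ , y′ , m′ , refl , e′ = cong₂ pt ZZ′ (trans ga (trans (cong f ZZ′) (sym ga′)))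
      where
      Z  = place a
      Z′ = place a′
      X  = Z +ᴰ h
      v  = value a R.∙ y
      XX′ : X ≡ Z′ +ᴰ h′
      XX′ = cong place eq
      vv′ : v ≡ value a′ R.∙ y′
      vv′ = cong value eq
      lands : ∀ Y {W k x} → W ≡ Y +ᴰ k → v ≡ f Y R.∙ x → v R.∙ (f (W -ᴰ k) R.⁻¹) ≡ x
      lands Y {k = k} refl vx rewrite +-ᴰ Y k | vx = R.∙-conjugate (f Y) _
      hh′ : h ≡ h′
      hh′ = unique X v m m′
        (trans (cong E (lands Z refl (cong (R._∙ y) ga))) e)
        (trans (cong E′ (lands Z′ XX′ (trans vv′ (cong (R._∙ y′) ga′)))) e′)
      ZZ′ : Z ≡ Z′
      ZZ′ = trans (sym (+-ᴰ Z h)) (trans (cong₂ _-ᴰ_ XX′ hh′) (+-ᴰ Z′ h′))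

  -- The tile {0} × R: its tilings are the graphs of functions.
  whole : List Piece
  whole = (0ᴰ , λ _ → true) ∷ []

  module Tiled (A : Subset) (A-whole : Tiles A (tile whole)) where

    private
      find : ∀ X → ∃ λ y → A (pt X y)
      find X with proj₁ A-whole (pt X R.ε)
      ... | a , p , Aa , p∈ , eq with ∈-tile⁻ whole p∈
      ... | _ , _ , y , here refl , refl , _ = value a , subst A (cong₂ pt ZX refl) Aa
        where
        ZX : place a ≡ X
        ZX = trans (sym (-ᴰ-0ᴰ (place a))) (cong place eq)

    f : D → R.Carrier
    f X = proj₁ (find X)

    A-f : ∀ X → A (pt X (f X))
    A-f X = proj₂ (find X)

    A⇒f : ∀ X y → A (pt X y) → y ≡ f X
    A⇒f X y Ay = proj₂ (pt-injective X X (proj₂ A-whole (pt X y) (pt X (f X)) (pt 0ᴰ (y R.⁻¹)) (pt 0ᴰ (f X R.⁻¹))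
      Ay (A-f X) (∈-tile⁺ whole (here refl) refl) (∈-tile⁺ whole (here refl) refl)
      (cong (pt (X +ᴰ 0ᴰ)) (trans (R.∙-inverseʳ y) (sym (R.∙-inverseʳ (f X)))))))

    -- Two pieces that cover the same point `pt X y` must start from the same element of `A`. The
    -- parity, range and invariance statements below all come from this by a suitable choice of `y`.
    disjoint : ∀ P → Tiles A (tile P) → ∀ X y {h E h′ E′} → (h , E) ∈ P → (h′ , E′) ∈ P →
      E ∋ y from f (X -ᴰ h) → E′ ∋ y from f (X -ᴰ h′) → X -ᴰ h ≡ X -ᴰ h′
    disjoint P A-P X y {h} {E} {h′} {E′} m m′ e e′ = proj₁ (pt-injective _ _
      (proj₂ A-P _ _ _ _ (A-f (X -ᴰ h)) (A-f (X -ᴰ h′)) (∈-tile⁺ P m e) (∈-tile⁺ P m′ e′)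
        (trans (sum h) (sym (sum h′)))))
      where
      sum : ∀ k → pt (X -ᴰ k) (f (X -ᴰ k)) ⊕ pt k (y R.∙ (f (X -ᴰ k) R.⁻¹)) ≡ pt X y
      sum k = let z = f (X -ᴰ k) in
        cong₂ pt (-+ᴰ X k) (trans (sym (R.∙-assoc z y (z R.⁻¹))) (R.∙-conjugate z y))

-- Boolean coordinates

e₁ e₂ tᴰ sᴰ : D
e₁ = (+ 1 , + 0 , false , false)
e₂ = (+ 0 , + 1 , false , false)
tᴰ = (+ 0 , + 0 , true , false)
sᴰ = (+ 0 , + 0 , false , true)

ℤ-constant : {B : Set} (F : ℤ → B) → (∀ z → F (z ℤ.- + 1) ≡ F z) → ∀ z → F z ≡ F (+ 0)
ℤ-constant F step (+ ℕ.zero)  = refl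
ℤ-constant F step (+ ℕ.suc n) = trans (sym (step (+ ℕ.suc n))) (ℤ-constant F step (+ n))
ℤ-constant F step -[1+ ℕ.zero ]  = step (+ 0)
-- The difference `-[1+ n ] - + 1` computes to `-[1+ suc (n + 0) ]`, hence the correction by
-- `+-identityʳ`.
ℤ-constant F step -[1+ ℕ.suc n ] = trans (cong (λ m → F -[1+ ℕ.suc m ]) (sym (ℕ.+-identityʳ n)))
  (trans (step -[1+ n ]) (ℤ-constant F step -[1+ n ]))

D-constant : {B : Set} (F : D → B) → (∀ X → F (X -ᴰ e₁) ≡ F X) → (∀ X → F (X -ᴰ e₂) ≡ F X) →
  (∀ X → F (X -ᴰ tᴰ) ≡ F X) → (∀ X → F (X -ᴰ sᴰ) ≡ F X) → ∀ X → F X ≡ F 0ᴰ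
D-constant F F₁ F₂ Fₜ Fₛ (a , b , t , s) =
  trans (ℤ-constant (λ z → F (z , b , t , s)) (λ z → trans (cong F (D-ext refl (sym (ℤ.+-identityʳ b)) (sym (xor-identityʳ t)) (sym (xor-identityʳ s)))) (F₁ (z , b , t , s))) a)
 (trans (ℤ-constant (λ z → F (+ 0 , z , t , s)) (λ z → trans (cong F (D-ext refl refl (sym (xor-identityʳ t)) (sym (xor-identityʳ s)))) (F₂ (+ 0 , z , t , s))) b)
 (trans (flip-t t s) (flip-s s)))
  where
  flip-t : ∀ t s → F (+ 0 , + 0 , t , s) ≡ F (+ 0 , + 0 , false , s)
  flip-t false s = refl
  flip-t true  s = trans (cong F (D-ext refl refl refl (sym (xor-identityʳ s)))) (Fₜ (+ 0 , + 0 , false , s))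
  flip-s : ∀ s → F (+ 0 , + 0 , false , s) ≡ F 0ᴰ
  flip-s false = refl
  flip-s true  = Fₛ 0ᴰ

-ᴰ-comm : ∀ X h k → (X -ᴰ h) -ᴰ k ≡ (X -ᴰ k) -ᴰ h
-ᴰ-comm (a , b , t , s) (c , d , t₁ , s₁) (e , g , t₂ , s₂) = D-ext (ℤ-comm a c e) (ℤ-comm b d g) (B-comm t t₁ t₂) (B-comm s s₁ s₂)
  where
  ℤ-comm : ∀ a c e → a ℤ.- c ℤ.- e ≡ a ℤ.- e ℤ.- c
  ℤ-comm a c e = trans (ℤ.+-assoc a (ℤ.- c) (ℤ.- e)) (trans (cong (λ z → a ℤ.+ z) (ℤ.+-comm (ℤ.- c) (ℤ.- e))) (sym (ℤ.+-assoc a (ℤ.- e) (ℤ.- c))))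
  B-comm : ∀ a c e → (a xor c) xor e ≡ (a xor e) xor c
  B-comm a c e = trans (xor-assoc a c e) (trans (cong (a xor_) (xor-comm c e)) (sym (xor-assoc a e c)))

-ᴰ-+ᴰ : ∀ X h k → X -ᴰ (h +ᴰ k) ≡ (X -ᴰ h) -ᴰ k
-ᴰ-+ᴰ (a , b , t , s) (c , d , t₁ , s₁) (e , g , t₂ , s₂) = D-ext (ℤ-sub a c e) (ℤ-sub b d g) (sym (xor-assoc t t₁ t₂)) (sym (xor-assoc s s₁ s₂))
  where
  ℤ-sub : ∀ a c e → a ℤ.- (c ℤ.+ e) ≡ a ℤ.- c ℤ.- e
  ℤ-sub a c e = trans (cong (λ z → a ℤ.+ z) (ℤ.neg-distrib-+ c e)) (sym (ℤ.+-assoc a (ℤ.- c) (ℤ.- e)))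

-ᴰ-t-t : ∀ X → (X -ᴰ tᴰ) -ᴰ tᴰ ≡ X
-ᴰ-t-t X = trans (sym (-ᴰ-+ᴰ X tᴰ tᴰ)) (-ᴰ-0ᴰ X)

is : Fin 4 → Fin 4 → Bool
is 0F 0F = true
is 1F 1F = true
is 2F 2F = true
is 3F 3F = true
is _  _  = false

even : Fin 4 → Bool
even 0F = true
even 1F = false
even 2F = true
even 3F = false

val : Bool → Fin 4
val false = 0F
val true  = 1F

-- The element a with {x , y} = {a , a + 1}; meaningful when x and y have opposite parity.
base : Fin 4 → Fin 4 → Fin 4
base x y = if is 1F (y ⊟ x) then x else y

by-cases : ∀ {A : Set} b → (b ≡ true → A) → (b ≡ false → A) → A
by-cases true  f g = f refl
by-cases false f g = g refl

allᵇ? : ∀ {P : Bool → Set} → (∀ b → Dec (P b)) → Dec (∀ b → P b)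
allᵇ? P? = map′ (λ { (p , q) false → p ; (p , q) true → q }) (λ p → p false , p true) (P? false ×-dec P? true)

infix 4 _≟ᵇ_
_≟ᵇ_ : (a b : Bool) → Dec (a ≡ b)
_≟ᵇ_ = Bool._≟_

opaque
  unfolding _⊞_ neg _⊟_

  ⊟-self : ∀ x → x ⊟ x ≡ 0F
  ⊟-self = from-yes (all? λ x → x ⊟ x Fin.≟ 0F)

  ⊞-⊟ : ∀ x y → x ⊞ neg y ≡ x ⊟ y
  ⊞-⊟ = from-yes (all? λ x → all? λ y → x ⊞ neg y Fin.≟ x ⊟ y)

  is-0-⊟ : ∀ x y → is 0F (x ⊟ y) ≡ true → x ≡ y
  is-0-⊟ = from-yes (all? λ x → all? λ y → (is 0F (x ⊟ y) ≟ᵇ true) →-dec (x Fin.≟ y))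

  ⊞-⊞ : ∀ a b c d → (a ⊞ b) ⊞ (c ⊞ d) ≡ (a ⊞ c) ⊞ (b ⊞ d)
  ⊞-⊞ = from-yes (all? λ a → all? λ b → all? λ c → all? λ d → (a ⊞ b) ⊞ (c ⊞ d) Fin.≟ (a ⊞ c) ⊞ (b ⊞ d))

  ⊟-⊞ : ∀ a b c d → (a ⊟ b) ⊞ (c ⊟ d) ≡ (a ⊞ c) ⊟ (b ⊞ d)
  ⊟-⊞ = from-yes (all? λ a → all? λ b → all? λ c → all? λ d → (a ⊟ b) ⊞ (c ⊟ d) Fin.≟ (a ⊞ c) ⊟ (b ⊞ d))

  ⊟-⊟ : ∀ a b c d → (a ⊟ b) ⊟ (c ⊟ d) ≡ (a ⊟ c) ⊟ (b ⊟ d)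
  ⊟-⊟ = from-yes (all? λ a → all? λ b → all? λ c → all? λ d → (a ⊟ b) ⊟ (c ⊟ d) Fin.≟ (a ⊟ c) ⊟ (b ⊟ d))

  ⊞-cancelˡ : ∀ c x y → c ⊞ x ≡ c ⊞ y → x ≡ y
  ⊞-cancelˡ = from-yes (all? λ c → all? λ x → all? λ y → (c ⊞ x Fin.≟ c ⊞ y) →-dec (x Fin.≟ y))

  base-comm : ∀ x y → even (x ⊟ y) ≡ false → base x y ≡ base y x
  base-comm = from-yes (all? λ x → all? λ y → (even (x ⊟ y) ≟ᵇ false) →-dec (base x y Fin.≟ base y x))

  -- Two different pairs of consecutive elements of ℤ/4 always contain elements at distance 2, one
  -- from each.
  base-≡ : ∀ a b c d → even (a ⊟ b) ≡ false → even (c ⊟ d) ≡ false →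
    is 2F (a ⊟ c) ≡ false → is 2F (a ⊟ d) ≡ false → is 2F (b ⊟ c) ≡ false → is 2F (b ⊟ d) ≡ false →
    base a b ≡ base c d
  base-≡ = from-yes (all? λ a → all? λ b → all? λ c → all? λ d →
    (even (a ⊟ b) ≟ᵇ false) →-dec ((even (c ⊟ d) ≟ᵇ false) →-dec ((is 2F (a ⊟ c) ≟ᵇ false) →-dec
    ((is 2F (a ⊟ d) ≟ᵇ false) →-dec ((is 2F (b ⊟ c) ≟ᵇ false) →-dec ((is 2F (b ⊟ d) ≟ᵇ false) →-dec
    (base a b Fin.≟ base c d)))))))

  base-val : ∀ x y → even (x ⊟ y) ≡ false → x ≡ base x y ⊞ val (is 1F (x ⊟ base x y))
  base-val = from-yes (all? λ x → all? λ y → (even (x ⊟ y) ≟ᵇ false) →-dec (x Fin.≟ base x y ⊞ val (is 1F (x ⊟ base x y))))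

  base-flip : ∀ x y → even (x ⊟ y) ≡ false → is 1F (y ⊟ base x y) ≡ not (is 1F (x ⊟ base x y))
  base-flip = from-yes (all? λ x → all? λ y → (even (x ⊟ y) ≟ᵇ false) →-dec (is 1F (y ⊟ base x y) ≟ᵇ not (is 1F (x ⊟ base x y))))

quad : Fin 4 → Fin 4 → Fin 4 → Fin 4 → Fin 4
quad a b c d = (a ⊞ b) ⊟ (c ⊞ d)

quad-cong : ∀ {a a′ b b′ c c′ d d′} → a ≡ a′ → b ≡ b′ → c ≡ c′ → d ≡ d′ → quad a b c d ≡ quad a′ b′ c′ d′
quad-cong refl refl refl refl = refl

quad-⊞ : ∀ a b c d a′ b′ c′ d′ → quad (a ⊞ a′) (b ⊞ b′) (c ⊞ c′) (d ⊞ d′) ≡ quad a b c d ⊞ quad a′ b′ c′ d′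
quad-⊞ a b c d a′ b′ c′ d′ = trans (cong₂ _⊟_ (⊞-⊞ a a′ b b′) (⊞-⊞ c c′ d d′)) (sym (⊟-⊞ _ _ _ _))

oppositePick : Bool → Fin 4 → Fin 2
oppositePick b y = if even (y ⊟ val b) then 0F else 1F

-- One test for each piece of a `range` tile, with b and c the Booleans at `X` and `X -ᴰ h`. The
-- values b and not b exhaust 0 and 1, and c + 2 and not c + 2 exhaust 2 and 3, so exactly one test
-- succeeds.
rangeTest : Bool → Bool → Fin 4 → Fin 4 → Bool
rangeTest b c y 0F = is 0F (y ⊟ val b)
rangeTest b c y 1F = is 0F (y ⊟ val (not b))
rangeTest b c y 2F = is 2F (y ⊟ val c)
rangeTest b c y 3F = is 2F (y ⊟ val (not c))

rangePick : Bool → Bool → Fin 4 → Fin 4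
rangePick b c y = if rangeTest b c y 0F then 0F else if rangeTest b c y 1F then 1F else if rangeTest b c y 2F then 2F else 3F

opaque
  unfolding _⊞_ neg _⊟_

  oppositeCover : ∀ b y → (oppositePick b y ≡ 0F × even (y ⊟ val b) ≡ true) ⊎ (oppositePick b y ≡ 1F × even (y ⊟ val (not b)) ≡ true)
  oppositeCover = from-yes (allᵇ? λ b → all? λ y → (oppositePick b y Fin.≟ 0F ×-dec even (y ⊟ val b) ≟ᵇ true) ⊎-dec (oppositePick b y Fin.≟ 1F ×-dec even (y ⊟ val (not b)) ≟ᵇ true))

  opposite₀ : ∀ b y → even (y ⊟ val b) ≡ true → 0F ≡ oppositePick b y
  opposite₀ = from-yes (allᵇ? λ b → all? λ y → even (y ⊟ val b) ≟ᵇ true →-dec 0F Fin.≟ oppositePick b y)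

  opposite₁ : ∀ b y → even (y ⊟ val (not b)) ≡ true → 1F ≡ oppositePick b y
  opposite₁ = from-yes (allᵇ? λ b → all? λ y → even (y ⊟ val (not b)) ≟ᵇ true →-dec 1F Fin.≟ oppositePick b y)

  rangeCover : ∀ b c y → rangeTest b c y (rangePick b c y) ≡ true
  rangeCover = from-yes (allᵇ? λ b → allᵇ? λ c → all? λ y → rangeTest b c y (rangePick b c y) ≟ᵇ true)

  rangeOnly : ∀ b c y i → rangeTest b c y i ≡ true → i ≡ rangePick b c y
  rangeOnly = from-yes (allᵇ? λ b → allᵇ? λ c → all? λ y → all? λ i → rangeTest b c y i ≟ᵇ true →-dec i Fin.≟ rangePick b c y)

-- Tiles that constrain the coordinates of the function

module Constraints {K : ℕ} {Var : Set} (iso : Fin K ↔ Var) where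

  R : FiniteAbelianGroup
  R = Vecᴳ Fin4ᴳ K

  open Graphs R public
  private module R = Laws R

  coord : Var → R.Carrier → Fin 4
  coord v y = lookup y (Inverse.from iso v)

  data Form : Set where
    single  : Var → Form
    balance : (p q r s : Var) → Form

  eval : Form → R.Carrier → Fin 4
  eval (single v)        y = coord v y
  eval (balance p q r s) y = quad (coord p y) (coord q y) (coord r y) (coord s y)

  coord-⊟ : ∀ v y x → coord v (y R.∙ (x R.⁻¹)) ≡ coord v y ⊟ coord v x
  coord-⊟ v y x = trans (lookup-zipWith _⊞_ i y (x R.⁻¹)) (trans (cong (lookup y i ⊞_) (lookup-map i neg x)) (⊞-⊟ _ _))
    where i = Inverse.from iso v

  eval-⊟ : ∀ φ y x → eval φ (y R.∙ (x R.⁻¹)) ≡ eval φ y ⊟ eval φ x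
  eval-⊟ (single v) y x = coord-⊟ v y x
  eval-⊟ (balance p q r s) y x = trans
    (quad-cong (coord-⊟ p y x) (coord-⊟ q y x) (coord-⊟ r y x) (coord-⊟ s y x))
    (trans (cong₂ _⊟_ (⊟-⊞ _ _ _ _) (⊟-⊞ _ _ _ _)) (⊟-⊟ _ _ _ _))

  data Constraint : Set where
    opposite : Var → Constraint
    range    : Var → D → Constraint
    inv      : Form → D → Constraint

  -- Write u for the coordinate `v` of the function. The tile for `opposite` puts u X and u (X - t)
  -- in different parity classes. The tile for `range` makes u X, u (X - t), u (X - h) + 2 and u (X
  -- - h - t) + 2 the four elements of ℤ/4. The tile for `inv` joins a level set of the form, placed
  -- from `X`, with the complement of one placed from `X -ᴰ h`, and these fit only if the two levels
  -- agree.
  pieces : Constraint → List Piece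
  pieces (opposite v) = (0ᴰ , λ y → even (coord v y)) ∷ (tᴰ , λ y → even (coord v y)) ∷ []
  pieces (range v h)  = (0ᴰ , λ y → is 0F (coord v y)) ∷ (tᴰ , λ y → is 0F (coord v y)) ∷
                        (h , λ y → is 2F (coord v y)) ∷ (h +ᴰ tᴰ , λ y → is 2F (coord v y)) ∷ []
  pieces (inv φ h)    = (0ᴰ , λ y → is 0F (eval φ y)) ∷ (h , λ y → not (is 0F (eval φ y))) ∷ []

  evalᵇ : Form → (Var → Bool) → Fin 4
  evalᵇ (single v)        x = val (x v)
  evalᵇ (balance p q r s) x = quad (val (x p)) (val (x q)) (val (x r)) (val (x s))

  Solves : (Var → D → Bool) → Constraint → Set
  Solves x (opposite v) = ⊤
  Solves x (range v h)  = ⊤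
  Solves x (inv φ h)    = ∀ X → evalᵇ φ (λ v → x v (X -ᴰ h)) ≡ evalᵇ φ (λ v → x v X)

  -- From tilings to Boolean arrays

  module Extract (A : Subset) (A-whole : Tiles A (tile whole)) where
    open Tiled A A-whole public

    u : Var → D → Fin 4
    u v X = coord v (f X)

    Holds : Constraint → Set
    Holds c = Tiles A (tile (pieces c))

    private
      f₀ : ∀ X → f (X -ᴰ 0ᴰ) ≡ f X
      f₀ X = cong f (-ᴰ-0ᴰ X)

      t≢0 : ∀ X → X -ᴰ 0ᴰ ≢ X -ᴰ tᴰ
      t≢0 (a , b , false , s) ()
      t≢0 (a , b , true , s) ()

    -- If the parities agreed, the value `f X` over `X` would be covered by both pieces.
    opposite-parity : ∀ v → Holds (opposite v) → ∀ X → even (u v X ⊟ u v (X -ᴰ tᴰ)) ≡ false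
    opposite-parity v T X = Bool.¬-not λ eq → t≢0 X (disjoint (pieces (opposite v)) T X (f X) (here refl) (there (here refl))
      (cong even (trans (coord-⊟ v (f X) (f (X -ᴰ 0ᴰ))) (trans (cong (λ z → u v X ⊟ coord v z) (f₀ X)) (⊟-self (u v X)))))
      (trans (cong even (coord-⊟ v (f X) (f (X -ᴰ tᴰ)))) eq))

    range-near : ∀ v h → Holds (range v h) → ∀ X k → (k , λ y → is 2F (coord v y)) ∈ pieces (range v h) →
      X -ᴰ 0ᴰ ≢ X -ᴰ k → is 2F (u v X ⊟ u v (X -ᴰ k)) ≡ false
    range-near v h T X k m k≢0 = Bool.¬-not λ eq → k≢0 (disjoint (pieces (range v h)) T X (f X) (here refl) m
      (cong (is 0F) (trans (coord-⊟ v (f X) (f (X -ᴰ 0ᴰ))) (trans (cong (λ z → u v X ⊟ coord v z) (f₀ X)) (⊟-self (u v X)))))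
      (trans (cong (is 2F) (coord-⊟ v (f X) (f (X -ᴰ k)))) eq))

    inv-≡ : ∀ φ h → Holds (inv φ h) → ∀ X → eval φ (f X) ≡ eval φ (f (X -ᴰ h))
    -- If the two values differ, both pieces cover `f X` over `X`. Disjointness then gives X = X -
    -- h, so the values are equal after all.
    inv-≡ φ h T X = by-cases (is 0F (eval φ (f X) ⊟ eval φ (f (X -ᴰ h)))) (is-0-⊟ _ _) λ eq → cong (λ Y → eval φ (f Y)) (trans (sym (-ᴰ-0ᴰ X)) (disjoint (pieces (inv φ h)) T X (f X) (here refl) (there (here refl))
      (cong (is 0F) (trans (eval-⊟ φ (f X) (f (X -ᴰ 0ᴰ))) (trans (cong (λ z → eval φ (f X) ⊟ eval φ z) (f₀ X)) (⊟-self (eval φ (f X))))))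
      (trans (cong (λ z → not (is 0F z)) (eval-⊟ φ (f X) (f (X -ᴰ h)))) (cong not eq))))

    β : Var → D → Fin 4
    β v X = base (u v X) (u v (X -ᴰ tᴰ))

    x : Var → D → Bool
    x v X = is 1F (u v X ⊟ β v 0ᴰ)

    module _ (v : Var) (opp : Holds (opposite v))
      (r₁ : Holds (range v e₁)) (r₂ : Holds (range v e₂)) (rₛ : Holds (range v sᴰ)) where

      -- The `range` tile excludes the difference 2 between the pair at `X` and the pair at
      -- `X -ᴰ h`, and `base-≡` applies. The differences that start from `X -ᴰ tᴰ` come from the
      -- equation at that point, since (X - t) - (h + t) = X - h.
      β-invariant : ∀ h → (∀ X → X -ᴰ 0ᴰ ≢ X -ᴰ h) → (∀ X → X -ᴰ 0ᴰ ≢ X -ᴰ (h +ᴰ tᴰ)) → Holds (range v h) →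
        ∀ X → β v (X -ᴰ h) ≡ β v X
      β-invariant h h≢0 ht≢0 T X = sym (base-≡ (u v X) (u v (X -ᴰ tᴰ)) (u v (X -ᴰ h)) (u v (X -ᴰ h -ᴰ tᴰ))
        (opposite-parity v opp X) (opposite-parity v opp (X -ᴰ h))
        (near X) (trans (cong (λ Y → is 2F (u v X ⊟ u v Y)) (sym (-ᴰ-+ᴰ X h tᴰ))) (near′ X))
        (trans (cong (λ Y → is 2F (u v (X -ᴰ tᴰ) ⊟ u v Y)) back) (near′ (X -ᴰ tᴰ)))
        (trans (cong (λ Y → is 2F (u v (X -ᴰ tᴰ) ⊟ u v Y)) (-ᴰ-comm X h tᴰ)) (near (X -ᴰ tᴰ))))
        where
        near : ∀ X → is 2F (u v X ⊟ u v (X -ᴰ h)) ≡ false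
        near X = range-near v h T X h (there (there (here refl))) (h≢0 X)
        near′ : ∀ X → is 2F (u v X ⊟ u v (X -ᴰ (h +ᴰ tᴰ))) ≡ false
        near′ X = range-near v h T X (h +ᴰ tᴰ) (there (there (there (here refl)))) (ht≢0 X)
        back : X -ᴰ h ≡ (X -ᴰ tᴰ) -ᴰ (h +ᴰ tᴰ)
        back = trans (sym (-ᴰ-t-t (X -ᴰ h))) (trans (cong (_-ᴰ tᴰ) (-ᴰ-comm X h tᴰ)) (sym (-ᴰ-+ᴰ (X -ᴰ tᴰ) h tᴰ)))

      private
        ℤ≢ : ∀ a → a ℤ.+ + 0 ≢ a ℤ.- + 1
        ℤ≢ a eq with ∙-cancelˡ a (+ 0) (ℤ.- + 1) eq
        ... | ()

      β-constant : ∀ X → β v X ≡ β v 0ᴰ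
      β-constant = D-constant (β v)
        (β-invariant e₁ (λ X eq → ℤ≢ (proj₁ X) (cong proj₁ eq)) (λ X eq → ℤ≢ (proj₁ X) (cong proj₁ eq)) r₁)
        (β-invariant e₂ (λ X eq → ℤ≢ (proj₁ (proj₂ X)) (cong (λ Y → proj₁ (proj₂ Y)) eq)) (λ X eq → ℤ≢ (proj₁ (proj₂ X)) (cong (λ Y → proj₁ (proj₂ Y)) eq)) r₂)
        (λ X → trans (cong (base (u v (X -ᴰ tᴰ))) (cong (u v) (-ᴰ-t-t X))) (sym (base-comm _ _ (opposite-parity v opp X))))
        (β-invariant sᴰ (λ { (a , b , t , false) () ; (a , b , t , true) () }) (λ { (a , b , t , false) () ; (a , b , t , true) () }) rₛ)

      u≡ : ∀ X → u v X ≡ β v 0ᴰ ⊞ val (x v X)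
      u≡ X = subst (λ b → u v X ≡ b ⊞ val (is 1F (u v X ⊟ b))) (β-constant X) (base-val _ _ (opposite-parity v opp X))

      x-flip : ∀ X → x v (X -ᴰ tᴰ) ≡ not (x v X)
      x-flip X = subst (λ b → is 1F (u v (X -ᴰ tᴰ) ⊟ b) ≡ not (is 1F (u v X ⊟ b))) (β-constant X) (base-flip _ _ (opposite-parity v opp X))

    x-single : ∀ v h → Holds (inv (single v) h) → ∀ X → x v (X -ᴰ h) ≡ x v X
    x-single v h T X = cong (λ z → is 1F (z ⊟ β v 0ᴰ)) (sym (inv-≡ (single v) h T X))

    -- The bases do not depend on the point, so they add the same unknown amount to both sides and
    -- cancel.
    x-balance : (∀ v X → u v X ≡ β v 0ᴰ ⊞ val (x v X)) → ∀ p q r s h → Holds (inv (balance p q r s) h) →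
      ∀ X → evalᵇ (balance p q r s) (λ v → x v (X -ᴰ h)) ≡ evalᵇ (balance p q r s) (λ v → x v X)
    x-balance u≡ p q r s h T X = ⊞-cancelˡ (quad (β p 0ᴰ) (β q 0ᴰ) (β r 0ᴰ) (β s 0ᴰ)) _ _
      (trans (sym (split (X -ᴰ h))) (trans (sym (inv-≡ (balance p q r s) h T X)) (split X)))
      where
      split : ∀ Y → eval (balance p q r s) (f Y) ≡
        quad (β p 0ᴰ) (β q 0ᴰ) (β r 0ᴰ) (β s 0ᴰ) ⊞ evalᵇ (balance p q r s) (λ v → x v Y)
      split Y = trans (quad-cong (u≡ p Y) (u≡ q Y) (u≡ r Y) (u≡ s Y)) (quad-⊞ _ _ _ _ _ _ _ _)

  -- From Boolean arrays to tilings

  module Build (x : Var → D → Bool) where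

    f : D → R.Carrier
    f X = tabulate (λ i → val (x (Inverse.to iso i) X))

    coord-f : ∀ v X → coord v (f X) ≡ val (x v X)
    coord-f v X = trans (lookup∘tabulate _ (Inverse.from iso v)) (cong (λ w → val (x w X)) (Inverse.strictlyInverseˡ iso v))

    Tiles-whole : Tiles (graph f) (tile whole)
    Tiles-whole = Tiles-graph f whole (λ X y → 0ᴰ , _ , here refl , refl) λ { X y (here refl) (here refl) _ _ → refl }

    Tiles-pick : ∀ P (pick : D → R.Carrier → Fin (length P)) →
      (∀ X y → let (h , E) = List.lookup P (pick X y) in E ∋ y from f (X -ᴰ h)) →
      (∀ X y i → let (h , E) = List.lookup P i in E ∋ y from f (X -ᴰ h) → i ≡ pick X y) →
      Tiles (graph f) (tile P)
    Tiles-pick P pick cover only = Tiles-graph f P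
      (λ X y → _ , _ , ∈-lookup (pick X y) , cover X y)
      (λ X y m m′ e e′ → cong proj₁ (trans (lookup-index m)
        (trans (cong (List.lookup P) (trans (number X y m e) (sym (number X y m′ e′)))) (sym (lookup-index m′)))))
      where
      number : ∀ X y {h E} (m : (h , E) ∈ P) → E ∋ y from f (X -ᴰ h) → index m ≡ pick X y
      number X y {h} {E} m e = only X y (index m) (subst (λ p → proj₂ p ∋ y from f (X -ᴰ proj₁ p)) (lookup-index m) e)

    private
      x₀ : ∀ v X → x v (X -ᴰ 0ᴰ) ≡ x v X
      x₀ v X = cong (x v) (-ᴰ-0ᴰ X)

      at : ∀ (E : Fin 4 → Bool) v X y {b} → x v X ≡ b → E (coord v (y R.∙ (f X R.⁻¹))) ≡ E (coord v y ⊟ val b)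
      at E v X y eq = cong E (trans (coord-⊟ v y _) (cong (coord v y ⊟_) (trans (coord-f v _) (cong val eq))))

    Tiles-opposite : ∀ v → (∀ X → x v (X -ᴰ tᴰ) ≡ not (x v X)) → Tiles (graph f) (tile (pieces (opposite v)))
    Tiles-opposite v flip = Tiles-pick (pieces (opposite v)) (λ X y → oppositePick (x v X) (coord v y)) cover
      (λ { X y 0F e → opposite₀ (x v X) (coord v y) (trans (sym (at even v _ y (x₀ v X))) e)
         ; X y 1F e → opposite₁ (x v X) (coord v y) (trans (sym (at even v _ y (flip X))) e) })
      where
      Test : D → R.Carrier → Fin 2 → Set
      Test X y i = let (h , E) = List.lookup (pieces (opposite v)) i in E ∋ y from f (X -ᴰ h)
      cover : ∀ X y → Test X y (oppositePick (x v X) (coord v y))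
      cover X y with oppositeCover (x v X) (coord v y)
      ... | inj₁ (eq , e) = subst (Test X y) (sym eq) (trans (at even v _ y (x₀ v X)) e)
      ... | inj₂ (eq , e) = subst (Test X y) (sym eq) (trans (at even v _ y (flip X)) e)

    Tiles-range : ∀ v h → (∀ X → x v (X -ᴰ tᴰ) ≡ not (x v X)) → Tiles (graph f) (tile (pieces (range v h)))
    Tiles-range v h flip = Tiles-pick (pieces (range v h)) (λ X y → rangePick (x v X) (x v (X -ᴰ h)) (coord v y))
      (λ X y → trans (test-at X y (rangePick (x v X) (x v (X -ᴰ h)) (coord v y))) (rangeCover (x v X) (x v (X -ᴰ h)) (coord v y)))
      (λ X y i e → rangeOnly (x v X) (x v (X -ᴰ h)) (coord v y) i (trans (sym (test-at X y i)) e))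
      where
      test-at : ∀ X y i → let (k , E) = List.lookup (pieces (range v h)) i in
        E (y R.∙ (f (X -ᴰ k) R.⁻¹)) ≡ rangeTest (x v X) (x v (X -ᴰ h)) (coord v y) i
      test-at X y 0F = at (is 0F) v _ y (x₀ v X)
      test-at X y 1F = at (is 0F) v _ y (flip X)
      test-at X y 2F = at (is 2F) v _ y refl
      test-at X y 3F = at (is 2F) v _ y (trans (cong (x v) (-ᴰ-+ᴰ X h tᴰ)) (flip (X -ᴰ h)))

    eval-f : ∀ φ X → eval φ (f X) ≡ evalᵇ φ (λ v → x v X)
    eval-f (single v) X = coord-f v X
    eval-f (balance p q r s) X = quad-cong (coord-f p X) (coord-f q X) (coord-f r X) (coord-f s X)

    Tiles-inv : ∀ φ h → (∀ X → evalᵇ φ (λ v → x v (X -ᴰ h)) ≡ evalᵇ φ (λ v → x v X)) → Tiles (graph f) (tile (pieces (inv φ h)))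
    Tiles-inv φ h eqv = Tiles-pick (pieces (inv φ h)) pick cover only
      where
      pick : D → R.Carrier → Fin 2
      pick X y = if is 0F (eval φ y ⊟ eval φ (f X)) then 0F else 1F
      at0 : ∀ X y → eval φ (y R.∙ (f (X -ᴰ 0ᴰ) R.⁻¹)) ≡ eval φ y ⊟ eval φ (f X)
      at0 X y = trans (eval-⊟ φ y _) (cong (λ Y → eval φ y ⊟ eval φ (f Y)) (-ᴰ-0ᴰ X))
      ath : ∀ X y → eval φ (y R.∙ (f (X -ᴰ h) R.⁻¹)) ≡ eval φ y ⊟ eval φ (f X)
      ath X y = trans (eval-⊟ φ y _) (cong (eval φ y ⊟_) (trans (eval-f φ (X -ᴰ h)) (trans (eqv X) (sym (eval-f φ X)))))
      cover : ∀ X y → let (k , E) = List.lookup (pieces (inv φ h)) (pick X y) in E ∋ y from f (X -ᴰ k)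
      cover X y = by-cases z (λ eq → subst Test (sym (pick-at eq)) (trans (cong (is 0F) (at0 X y)) eq))
        (λ eq → subst Test (sym (pick-at eq)) (trans (cong (λ z → not (is 0F z)) (ath X y)) (cong not eq)))
        where
        z = is 0F (eval φ y ⊟ eval φ (f X))
        pick-at : ∀ {b} → z ≡ b → pick X y ≡ (if b then 0F else 1F)
        pick-at = cong (λ b → if b then 0F else 1F)
        Test : Fin 2 → Set
        Test i = let (k , E) = List.lookup (pieces (inv φ h)) i in E ∋ y from f (X -ᴰ k)
      only : ∀ X y i → let (k , E) = List.lookup (pieces (inv φ h)) i in E ∋ y from f (X -ᴰ k) → i ≡ pick X y
      only X y 0F e = sym (cong (λ b → if b then 0F else 1F) (trans (cong (is 0F) (sym (at0 X y))) e))
      only X y 1F e = sym (cong (λ b → if b then 0F else 1F) (trans (sym (not-involutive _))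
        (cong not (trans (cong (λ z → not (is 0F z)) (sym (ath X y))) e))))

    Tiles-constraint : ∀ c → (∀ v X → x v (X -ᴰ tᴰ) ≡ not (x v X)) → Solves x c → Tiles (graph f) (tile (pieces c))
    Tiles-constraint (opposite v) flip _ = Tiles-opposite v (flip v)
    Tiles-constraint (range v h)  flip _ = Tiles-range v h (flip v)
    Tiles-constraint (inv φ h)    flip e = Tiles-inv φ h e

-- Boolean arrays constant along directions, with forbidden patterns

each : ∀ {C : Set} n → (Fin n → List C) → List C
each ℕ.zero    F = []
each (ℕ.suc n) F = F zero ++ each n (F ∘ suc)

each⁺ : ∀ {C : Set} {P : C → Set} n {F : Fin n → List C} → (∀ i → All P (F i)) → All P (each n F)
each⁺ ℕ.zero    p = []
each⁺ (ℕ.suc n) p = ++⁺ (p zero) (each⁺ n (p ∘ suc))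

each⁻ : ∀ {C : Set} {P : C → Set} n (F : Fin n → List C) → All P (each n F) → ∀ i → All P (F i)
each⁻ (ℕ.suc n) F p zero    = ++⁻ˡ (F zero) p
each⁻ (ℕ.suc n) F p (suc i) = each⁻ n (F ∘ suc) (++⁻ʳ (F zero) p) i

lookup-All : ∀ {C : Set} {P : C → Set} (xs : List C) → (∀ i → P (List.lookup xs i)) → All P xs
lookup-All []       p = []
lookup-All (x ∷ xs) p = p zero ∷ lookup-All xs (p ∘ suc)

orFrom : ∀ {k} → (Fin k → Bool) → Fin (ℕ.suc k) → Bool
orFrom {ℕ.zero}  l zero    = false
orFrom {ℕ.suc k} l zero    = l zero ∨ orFrom (l ∘ suc) zero
orFrom {ℕ.suc k} l (suc j) = orFrom (l ∘ suc) j

orFrom-step : ∀ {k} (l : Fin k → Bool) i → orFrom l (inject₁ i) ≡ l i ∨ orFrom l (suc i)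
orFrom-step l zero    = refl
orFrom-step l (suc i) = orFrom-step (l ∘ suc) i

orFrom-last : ∀ {k} (l : Fin k → Bool) → orFrom l (fromℕ k) ≡ false
orFrom-last {ℕ.zero}  l = refl
orFrom-last {ℕ.suc k} l = orFrom-last (l ∘ suc)

orFrom-first : ∀ {k} (l : Fin k → Bool) i → l i ≡ true → orFrom l zero ≡ true
orFrom-first l zero    e rewrite e = refl
orFrom-first l (suc i) e = trans (cong (l zero ∨_) (orFrom-first (l ∘ suc) i e)) (Bool.∨-zeroʳ (l zero))

balanceᵇ : Bool → Bool → Bool → Bool → Fin 4
balanceᵇ p q r s = quad (val p) (val q) (val r) (val s)

-- The hypotheses compare a balance at a point with its value at the sign flip of this point
-- and at a point of the dummy layer.
opaque
  unfolding _⊞_ neg _⊟_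

  pin-sound : ∀ a w a′ w′ → balanceᵇ false true a w ≡ balanceᵇ true false (not a) (not w) →
    balanceᵇ false true a w ≡ balanceᵇ true true a′ w′ → a′ ≡ true
  pin-sound = from-yes (allᵇ? λ a → allᵇ? λ w → allᵇ? λ a′ → allᵇ? λ w′ →
    balanceᵇ false true a w Fin.≟ balanceᵇ true false (not a) (not w) →-dec
    balanceᵇ false true a w Fin.≟ balanceᵇ true true a′ w′ →-dec a′ ≟ᵇ true)

  start-sound : ∀ a → balanceᵇ a true false true ≡ balanceᵇ true true true true → a ≡ false
  start-sound = from-yes (allᵇ? λ a → balanceᵇ a true false true Fin.≟ balanceᵇ true true true true →-dec a ≟ᵇ false)

  step⁺-sound : ∀ l n z l′ n′ → balanceᵇ z l true n ≡ balanceᵇ (not z) (not l) false (not n) →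
    balanceᵇ z l true n ≡ balanceᵇ true l′ true n′ → z ≡ true ⊎ l ≡ true
  step⁺-sound = from-yes (allᵇ? λ l → allᵇ? λ n → allᵇ? λ z → allᵇ? λ l′ → allᵇ? λ n′ →
    balanceᵇ z l true n Fin.≟ balanceᵇ (not z) (not l) false (not n) →-dec
    balanceᵇ z l true n Fin.≟ balanceᵇ true l′ true n′ →-dec (z ≟ᵇ true ⊎-dec l ≟ᵇ true))

  step⁻-sound : ∀ l n z l′ n′ → balanceᵇ z n true l ≡ balanceᵇ (not z) (not n) false (not l) →
    balanceᵇ z n true l ≡ balanceᵇ true n′ true l′ → z ≡ true ⊎ l ≡ false
  step⁻-sound = from-yes (allᵇ? λ l → allᵇ? λ n → allᵇ? λ z → allᵇ? λ l′ → allᵇ? λ n′ →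
    balanceᵇ z n true l Fin.≟ balanceᵇ (not z) (not n) false (not l) →-dec
    balanceᵇ z n true l Fin.≟ balanceᵇ true n′ true l′ →-dec (z ≟ᵇ true ⊎-dec l ≟ᵇ false))

  final-sound : ∀ a → balanceᵇ a true true true ≡ balanceᵇ true true true true → a ≡ true
  final-sound = from-yes (allᵇ? λ a → balanceᵇ a true true true Fin.≟ balanceᵇ true true true true →-dec a ≟ᵇ true)

  pin-complete : ∀ s o t → balanceᵇ (s xor t) (true xor t) ((s ∨ o) xor t) ((s ∨ not o) xor t) ≡ 0F
  pin-complete = from-yes (allᵇ? λ s → allᵇ? λ o → allᵇ? λ t →
    balanceᵇ (s xor t) (true xor t) ((s ∨ o) xor t) ((s ∨ not o) xor t) Fin.≟ 0F)

  start-complete : ∀ s t → balanceᵇ ((s ∨ false) xor t) (true xor t) (s xor t) (true xor t) ≡ 0F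
  start-complete = from-yes (allᵇ? λ s → allᵇ? λ t →
    balanceᵇ ((s ∨ false) xor t) (true xor t) (s xor t) (true xor t) Fin.≟ 0F)

  step⁺-complete : ∀ s o l t →
    balanceᵇ ((s ∨ o) xor t) (l xor t) ((s ∨ ((l xor false) ∨ o)) xor t) (((s ∨ o) ∧ l) xor t) ≡ 0F
  step⁺-complete = from-yes (allᵇ? λ s → allᵇ? λ o → allᵇ? λ l → allᵇ? λ t →
    balanceᵇ ((s ∨ o) xor t) (l xor t) ((s ∨ ((l xor false) ∨ o)) xor t) (((s ∨ o) ∧ l) xor t) Fin.≟ 0F)

  step⁻-complete : ∀ s o l t →
    balanceᵇ ((s ∨ o) xor t) ((not (s ∨ o) ∨ l) xor t) ((s ∨ ((l xor true) ∨ o)) xor t) (l xor t) ≡ 0F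
  step⁻-complete = from-yes (allᵇ? λ s → allᵇ? λ o → allᵇ? λ l → allᵇ? λ t →
    balanceᵇ ((s ∨ o) xor t) ((not (s ∨ o) ∨ l) xor t) ((s ∨ ((l xor true) ∨ o)) xor t) (l xor t) Fin.≟ 0F)

  final-complete : ∀ s t → balanceᵇ ((s ∨ true) xor t) (true xor t) (true xor t) (true xor t) ≡ 0F
  final-complete = from-yes (allᵇ? λ s → allᵇ? λ t →
    balanceᵇ ((s ∨ true) xor t) (true xor t) (true xor t) (true xor t) Fin.≟ 0F)

module Patterns (k N : ℕ) (direction : Fin k → List (ℤ × ℤ × Bool)) (forbidden : Fin N → Fin k → Bool) where

  record Valid (g : Fin k → ℤ → ℤ → Bool) : Set where
    field
      directional : ∀ i → All (λ { (v , w , ε) → ∀ a b → g i (a ℤ.- v) (b ℤ.- w) ≡ g i a b xor ε }) (direction i)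
      avoids      : ∀ c a b → ∃ λ i → g i a b ≢ forbidden c i

  Var : Set
  Var = Fin 2 ⊎ (Fin k ⊎ ((Fin N × Fin (ℕ.suc k)) ⊎ ((Fin N × Fin (ℕ.suc k)) ⊎ (Fin N × Fin k))))

  opaque
    K : ℕ
    K = 2 ℕ.+ (k ℕ.+ (N ℕ.* ℕ.suc k ℕ.+ (N ℕ.* ℕ.suc k ℕ.+ N ℕ.* k)))

    iso : Fin K ↔ Var
    iso = ↔-trans (+↔⊎ {2}) (↔-refl ⊎-↔ ↔-trans (+↔⊎ {k}) (↔-refl ⊎-↔ ↔-trans (+↔⊎ {N ℕ.* ℕ.suc k})
      (*↔× {N} ⊎-↔ ↔-trans (+↔⊎ {N ℕ.* ℕ.suc k}) (*↔× {N} ⊎-↔ *↔× {N}))))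

  -- ⊤ᵛ is true and layerᵛ tells the dummy layer from the real one. The chain orᵛ c j says that
  -- the pattern c is violated at some index ≥ j; pinᵛ forces it to be true on the dummy layer,
  -- which removes the ambiguity of the constants of the balance equations.
  pattern ⊤ᵛ        = inj₁ 0F
  pattern layerᵛ    = inj₁ 1F
  pattern var i     = inj₂ (inj₁ i)
  pattern orᵛ c j   = inj₂ (inj₂ (inj₁ (c , j)))
  pattern pinᵛ c j  = inj₂ (inj₂ (inj₂ (inj₁ (c , j))))
  pattern slack c i = inj₂ (inj₂ (inj₂ (inj₂ (c , i))))

  open Constraints iso public

  constant : (p q r s : Var) → List Constraint
  constant p q r s = inv φ e₁ ∷ inv φ e₂ ∷ inv φ tᴰ ∷ inv φ sᴰ ∷ []
    where φ = balance p q r s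

  -- With constant 0 the balance reads or (i+1) + literal = or i + slack, so a true `or` passes to
  -- its successor or to the literal. The literal is the variable if the pattern asks for false.
  -- Otherwise it is the negation, and the variable and the slack change sides.
  stepᵇ : Bool → Fin N → Fin k → List Constraint
  stepᵇ true  c i = constant (orᵛ c (suc i)) (slack c i) (orᵛ c (inject₁ i)) (var i)
  stepᵇ false c i = constant (orᵛ c (suc i)) (var i) (orᵛ c (inject₁ i)) (slack c i)

  step : Fin N → Fin k → List Constraint
  step c i = stepᵇ (forbidden c i) c i

  boolean : Var → List Constraint
  boolean v = opposite v ∷ range v e₁ ∷ range v e₂ ∷ range v sᴰ ∷ []

  -- Since every coordinate is negated by `tᴰ`, invariance under `sᴰ +ᴰ tᴰ` means that `layerᵛ`
  -- changes from one layer to the other.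
  references : List Constraint
  references = inv (single ⊤ᵛ) e₁ ∷ inv (single ⊤ᵛ) e₂ ∷ inv (single ⊤ᵛ) sᴰ ∷
    inv (single layerᵛ) e₁ ∷ inv (single layerᵛ) e₂ ∷ inv (single layerᵛ) (sᴰ +ᴰ tᴰ) ∷ []

  -- For ε = true the translation is combined with the sign flip, which turns invariance into
  -- alternation.
  along : Fin k → ℤ × ℤ × Bool → Constraint
  along i (v , w , ε) = inv (single (var i)) (v , w , ε , false)

  -- With constant 0, `pins` says layer + 1 = or + pin, which is 2 on the dummy layer and so makes
  -- `or` true there. Then `starts` says that the last `or` equals the layer, hence is false on the
  -- real one, and `finals` that the first `or` is true.
  pins starts steps finals : Fin N → List Constraint
  pins c   = each (ℕ.suc k) (λ j → constant layerᵛ ⊤ᵛ (orᵛ c j) (pinᵛ c j))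
  starts c = constant (orᵛ c (fromℕ k)) ⊤ᵛ layerᵛ ⊤ᵛ
  steps c  = each k (step c)
  finals c = constant (orᵛ c zero) ⊤ᵛ ⊤ᵛ ⊤ᵛ

  clause : Fin N → List Constraint
  clause c = pins c ++ (starts c ++ (steps c ++ finals c))

  booleans alongs constraints : List Constraint
  booleans = each K (λ i → boolean (Inverse.to iso i))
  alongs   = each k (λ i → map (along i) (direction i))
  constraints = booleans ++ (references ++ (alongs ++ each N clause))

  tiles : List (List G)
  tiles = tile whole ∷ map (λ c → tile (pieces c)) constraints

  private
    minus-t : ∀ a b t s → (a , b , t , s) -ᴰ tᴰ ≡ (a , b , not t , s)
    minus-t a b t s = D-ext (ℤ.+-identityʳ a) (ℤ.+-identityʳ b) (xor-comm t true) (xor-identityʳ s)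

  module Sound (A : Subset) (A-whole : Tiles A (tile whole)) (Hs : All (Extract.Holds A A-whole) constraints) where
    open Extract A A-whole

    private
      Hs₂ : All Holds (references ++ (alongs ++ each N clause))
      Hs₂ = ++⁻ʳ booleans Hs

      Hs₃ : All Holds (alongs ++ each N clause)
      Hs₃ = ++⁻ʳ references Hs₂

      Hs₄ : ∀ i → All Holds (map (along i) (direction i))
      Hs₄ = each⁻ k (λ i → map (along i) (direction i)) (++⁻ˡ alongs Hs₃)

      Hs₅ : ∀ c → All Holds (clause c)
      Hs₅ = each⁻ N clause (++⁻ʳ alongs Hs₃)

      Hᵇ : ∀ v → All Holds (boolean v)
      Hᵇ v = subst (All Holds ∘ boolean) (Inverse.strictlyInverseˡ iso v) (each⁻ K (λ i → boolean (Inverse.to iso i)) (++⁻ˡ booleans Hs) (Inverse.from iso v))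

      flip-from : ∀ v → All Holds (boolean v) → ∀ X → x v (X -ᴰ tᴰ) ≡ not (x v X)
      flip-from v (o ∷ r₁ ∷ r₂ ∷ rₛ ∷ []) = x-flip v o r₁ r₂ rₛ

      u-from : ∀ v → All Holds (boolean v) → ∀ X → u v X ≡ β v 0ᴰ ⊞ val (x v X)
      u-from v (o ∷ r₁ ∷ r₂ ∷ rₛ ∷ []) = u≡ v o r₁ r₂ rₛ

    flip : ∀ v X → x v (X -ᴰ tᴰ) ≡ not (x v X)
    flip v = flip-from v (Hᵇ v)

    x-notᵗ : ∀ v a b t s → x v (a , b , not t , s) ≡ not (x v (a , b , t , s))
    x-notᵗ v a b t s = trans (cong (x v) (sym (minus-t a b t s))) (flip v (a , b , t , s))

    u-val : ∀ v X → u v X ≡ β v 0ᴰ ⊞ val (x v X)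
    u-val v = u-from v (Hᵇ v)

    constant-sound : ∀ p q r s → All Holds (constant p q r s) → ∀ X Y →
      balanceᵇ (x p X) (x q X) (x r X) (x s X) ≡ balanceᵇ (x p Y) (x q Y) (x r Y) (x s Y)
    constant-sound p q r s (h₁ ∷ h₂ ∷ h₃ ∷ h₄ ∷ []) X Y = trans (at0 X) (sym (at0 Y))
      where
      at0 = D-constant (λ X → balanceᵇ (x p X) (x q X) (x r X) (x s X))
        (x-balance u-val p q r s e₁ h₁) (x-balance u-val p q r s e₂ h₂)
        (x-balance u-val p q r s tᴰ h₃) (x-balance u-val p q r s sᴰ h₄)

    -- A solution is known only up to a global sign flip and an exchange of the layers. These are
    -- the sheet on which `⊤ᵛ` is true and the layer on which `layerᵛ` is then false.
    t₀ s₀ : Bool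
    t₀ = not (x ⊤ᵛ 0ᴰ)
    s₀ = x layerᵛ 0ᴰ xor t₀

    private
      Hʳ : All Holds references
      Hʳ = ++⁻ˡ references Hs₂

      hold : ∀ {c} → c ∈ references → Holds c
      hold = All.lookup Hʳ

      tᵒᶠ sᵒᶠ : D → Bool
      tᵒᶠ X = proj₁ (proj₂ (proj₂ X))
      sᵒᶠ X = proj₂ (proj₂ (proj₂ X))

    ⊤ᵛ-true : ∀ a b s → x ⊤ᵛ (a , b , t₀ , s) ≡ true
    ⊤ᵛ-true a b s = cancel (x ⊤ᵛ (a , b , t₀ , s)) (x ⊤ᵛ 0ᴰ) (D-constant (λ X → x ⊤ᵛ X xor tᵒᶠ X)
        (λ X → cong₂ _xor_ (x-single ⊤ᵛ e₁ (hold (here refl)) X) (xor-identityʳ _))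
        (λ X → cong₂ _xor_ (x-single ⊤ᵛ e₂ (hold (there (here refl))) X) (xor-identityʳ _))
        (λ X → trans (cong₂ _xor_ (flip ⊤ᵛ X) (xor-comm _ true)) (xor-annihilates-not (x ⊤ᵛ X) _))
        (λ X → cong₂ _xor_ (x-single ⊤ᵛ sᴰ (hold (there (there (here refl)))) X) (xor-identityʳ _)) (a , b , t₀ , s))
      where
      cancel : ∀ y z → y xor not z ≡ z xor false → y ≡ true
      cancel = from-yes (allᵇ? λ y → allᵇ? λ z → y xor not z ≟ᵇ z xor false →-dec y ≟ᵇ true)

    layerᵛ-layer : ∀ a b s → x layerᵛ (a , b , t₀ , s) ≡ s xor s₀
    layerᵛ-layer a b s = cancel (x layerᵛ (a , b , t₀ , s)) (x layerᵛ 0ᴰ) t₀ s (D-constant (λ X → x layerᵛ X xor (tᵒᶠ X xor sᵒᶠ X))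
        (λ X → cong₂ _xor_ (x-single layerᵛ e₁ (hold (there (there (there (here refl))))) X) (cong₂ _xor_ (xor-identityʳ (tᵒᶠ X)) (xor-identityʳ (sᵒᶠ X))))
        (λ X → cong₂ _xor_ (x-single layerᵛ e₂ (hold (there (there (there (there (here refl)))))) X) (cong₂ _xor_ (xor-identityʳ (tᵒᶠ X)) (xor-identityʳ (sᵒᶠ X))))
        (λ X → trans (cong (_xor (tᵒᶠ (X -ᴰ tᴰ) xor sᵒᶠ (X -ᴰ tᴰ))) (flip layerᵛ X)) (swap₁ (x layerᵛ X) (tᵒᶠ X) (sᵒᶠ X)))
        (λ X → trans (cong (_xor (tᵒᶠ (X -ᴰ sᴰ) xor sᵒᶠ (X -ᴰ sᴰ))) (flip-s X)) (swap₂ (x layerᵛ X) (tᵒᶠ X) (sᵒᶠ X)))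
        (a , b , t₀ , s))
      where
      swap₁ : ∀ y t s → not y xor ((t xor true) xor (s xor false)) ≡ y xor (t xor s)
      swap₁ = from-yes (allᵇ? λ y → allᵇ? λ t → allᵇ? λ s → not y xor ((t xor true) xor (s xor false)) ≟ᵇ y xor (t xor s))
      swap₂ : ∀ y t s → not y xor ((t xor false) xor (s xor true)) ≡ y xor (t xor s)
      swap₂ = from-yes (allᵇ? λ y → allᵇ? λ t → allᵇ? λ s → not y xor ((t xor false) xor (s xor true)) ≟ᵇ y xor (t xor s))
      flip-s : ∀ X → x layerᵛ (X -ᴰ sᴰ) ≡ not (x layerᵛ X)
      flip-s X = trans (sym (not-involutive _)) (cong not (trans (sym (flip layerᵛ (X -ᴰ sᴰ)))
        (trans (cong (x layerᵛ) (sym (-ᴰ-+ᴰ X sᴰ tᴰ)))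
        (x-single layerᵛ (sᴰ +ᴰ tᴰ) (hold (there (there (there (there (there (here refl))))))) X))))
      cancel : ∀ y p t s → y xor (t xor s) ≡ p xor false → y ≡ s xor (p xor t)
      cancel = from-yes (allᵇ? λ y → allᵇ? λ p → allᵇ? λ t → allᵇ? λ s → y xor (t xor s) ≟ᵇ p xor false →-dec y ≟ᵇ s xor (p xor t))

    compare : ∀ p q r s → All Holds (constant p q r s) → ∀ X Y {p₁ q₁ r₁ s₁ p₂ q₂ r₂ s₂} →
      x p X ≡ p₁ → x q X ≡ q₁ → x r X ≡ r₁ → x s X ≡ s₁ →
      x p Y ≡ p₂ → x q Y ≡ q₂ → x r Y ≡ r₂ → x s Y ≡ s₂ → balanceᵇ p₁ q₁ r₁ s₁ ≡ balanceᵇ p₂ q₂ r₂ s₂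
    compare p q r s H X Y refl refl refl refl refl refl refl refl = constant-sound p q r s H X Y

    g : Fin k → ℤ → ℤ → Bool
    g i a b = x (var i) (a , b , t₀ , s₀)

    private
      dummy : D
      dummy = (+ 0 , + 0 , t₀ , not s₀)

      layer-real : ∀ a b → x layerᵛ (a , b , t₀ , s₀) ≡ false
      layer-real a b = trans (layerᵛ-layer a b s₀) (xor-same s₀)

      layer-dummy : x layerᵛ dummy ≡ true
      layer-dummy = trans (layerᵛ-layer (+ 0) (+ 0) (not s₀)) (Bool.xor-inverseˡ s₀)

      flipped : ∀ {v b e} a → x v (a , b , t₀ , s₀) ≡ e → x v (a , b , not t₀ , s₀) ≡ not e
      flipped {v} {b} a refl = x-notᵗ v a b t₀ s₀

    -- On the real layer the balance is 1 - or - pin, one of -1, 0, 1, and the sign flip makes it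
    -- equal to its negative, so it is 0. On the dummy layer this leaves or + pin = 2.
    pinned : ∀ c j → x (orᵛ c j) dummy ≡ true
    pinned c j = pin-sound _ _ _ _
      (compare layerᵛ ⊤ᵛ (orᵛ c j) (pinᵛ c j) H X X̄ (layer-real _ _) (⊤ᵛ-true _ _ _) refl refl
        (flipped _ (layer-real _ _)) (flipped _ (⊤ᵛ-true _ _ _)) (flipped _ refl) (flipped _ refl))
      (compare layerᵛ ⊤ᵛ (orᵛ c j) (pinᵛ c j) H X dummy (layer-real _ _) (⊤ᵛ-true _ _ _) refl refl
        layer-dummy (⊤ᵛ-true _ _ _) refl refl)
      where
      X X̄ : D
      X = (+ 0 , + 0 , t₀ , s₀)
      X̄ = (+ 0 , + 0 , not t₀ , s₀)
      H = each⁻ (ℕ.suc k) (λ j → constant layerᵛ ⊤ᵛ (orᵛ c j) (pinᵛ c j)) (++⁻ˡ (pins c) {starts c ++ (steps c ++ finals c)} (Hs₅ c)) j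

    module _ (c : Fin N) (a b : ℤ) where
      private
        X X̄ : D
        X = (a , b , t₀ , s₀)
        X̄ = (a , b , not t₀ , s₀)

        H₂ : All Holds (starts c ++ (steps c ++ finals c))
        H₂ = ++⁻ʳ (pins c) (Hs₅ c)

        H₃ : All Holds (steps c ++ finals c)
        H₃ = ++⁻ʳ (starts c) H₂

        H-start : All Holds (starts c)
        H-start = ++⁻ˡ (starts c) H₂

        H-step : ∀ i → All Holds (step c i)
        H-step = each⁻ k (step c) (++⁻ˡ (steps c) H₃)

        H-final : All Holds (finals c)
        H-final = ++⁻ʳ (steps c) H₃

      start : x (orᵛ c (fromℕ k)) X ≡ false
      start = start-sound _ (compare (orᵛ c (fromℕ k)) ⊤ᵛ layerᵛ ⊤ᵛ H-start X dummy
        refl (⊤ᵛ-true _ _ _) (layer-real a b) (⊤ᵛ-true _ _ _) (pinned c (fromℕ k)) (⊤ᵛ-true _ _ _) layer-dummy (⊤ᵛ-true _ _ _))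

      final : x (orᵛ c zero) X ≡ true
      final = final-sound _ (compare (orᵛ c zero) ⊤ᵛ ⊤ᵛ ⊤ᵛ H-final X dummy
        refl (⊤ᵛ-true _ _ _) (⊤ᵛ-true _ _ _) (⊤ᵛ-true _ _ _) (pinned c zero) (⊤ᵛ-true _ _ _) (⊤ᵛ-true _ _ _) (⊤ᵛ-true _ _ _))

      -- On the dummy layer both `or` terms are pinned to true and cancel, so the balance is a
      -- difference of two Booleans. With the sign flip this makes the constant 0.
      next : ∀ i f → All Holds (stepᵇ f c i) → x (orᵛ c (inject₁ i)) X ≡ true → x (orᵛ c (suc i)) X ≡ true ⊎ g i a b ≡ not f
      next i true H e = step⁻-sound _ _ _ _ _
        (compare (orᵛ c (suc i)) (slack c i) (orᵛ c (inject₁ i)) (var i) H X X̄ refl refl e refl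
          (flipped a refl) (flipped a refl) (flipped a e) (flipped a refl))
        (compare (orᵛ c (suc i)) (slack c i) (orᵛ c (inject₁ i)) (var i) H X dummy refl refl e refl
          (pinned c (suc i)) refl (pinned c (inject₁ i)) refl)
      next i false H e = step⁺-sound _ _ _ _ _
        (compare (orᵛ c (suc i)) (var i) (orᵛ c (inject₁ i)) (slack c i) H X X̄ refl refl e refl
          (flipped a refl) (flipped a refl) (flipped a e) (flipped a refl))
        (compare (orᵛ c (suc i)) (var i) (orᵛ c (inject₁ i)) (slack c i) H X dummy refl refl e refl
          (pinned c (suc i)) refl (pinned c (inject₁ i)) refl)

      violated : ∀ j → x (orᵛ c j) X ≡ true → ∃ λ i → g i a b ≢ forbidden c i
      violated = >-weakInduction (λ j → x (orᵛ c j) X ≡ true → ∃ λ i → g i a b ≢ forbidden c i)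
        (λ e → ⊥-elim (Bool.not-¬ (trans (sym start) e) refl))
        (λ i ih e → [ ih , (λ e′ → i , λ e″ → Bool.not-¬ refl (trans (sym e″) e′)) ]′ (next i (forbidden c i) (H-step i) e))

    valid : Valid g
    valid = record
      { directional = λ i → All.map (λ {d} H a b → shifted i d H a b) (map⁻ (Hs₄ i))
      ; avoids = λ c a b → violated c a b zero (final c a b) }
      where
      shifted : ∀ i d → Holds (along i d) → let (v , w , ε) = d in ∀ a b → g i (a ℤ.- v) (b ℤ.- w) ≡ g i a b xor ε
      shifted i (v , w , false) H a b = trans (cong (x (var i)) (D-ext refl refl (sym (xor-identityʳ _)) (sym (xor-identityʳ _))))
        (trans (x-single (var i) (v , w , false , false) H (a , b , t₀ , s₀)) (sym (xor-identityʳ _)))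
      shifted i (v , w , true) H a b = trans (cong (x (var i)) (D-ext refl refl (sym (not-xor-true _)) (sym (xor-identityʳ _))))
        (trans (x-single (var i) (v , w , true , false) H (a , b , not t₀ , s₀)) (trans (x-notᵗ (var i) a b t₀ s₀) (xor-comm true _)))
        where
        not-xor-true : ∀ t → not t xor true ≡ t
        not-xor-true true  = refl
        not-xor-true false = refl

    translation-invariant : ∀ p → (∀ X y → A (pt X y) → A (pt (X +ᴰ (p , + 0 , false , false)) y)) →
      ∀ i a b → g i (a ℤ.+ p) b ≡ g i a b
    translation-invariant p inv-A i a b = cong (λ y → is 1F (coord (var i) y ⊟ β (var i) 0ᴰ))
      (trans (cong f (D-ext refl (sym (ℤ.+-identityʳ b)) (sym (xor-identityʳ _)) (sym (xor-identityʳ _))))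
        (sym (A⇒f _ _ (inv-A X (f X) (A-f X)))))
      where X = (a , b , t₀ , s₀)

  module Complete (g : Fin k → ℤ → ℤ → Bool) (valid : Valid g) where
    open Valid valid

    violation : Fin N → ℤ → ℤ → Fin k → Bool
    violation c a b i = g i a b xor forbidden c i

    or : Fin N → Fin (ℕ.suc k) → ℤ → ℤ → Bool
    or c j a b = orFrom (violation c a b) j

    -- The term that completes the balance: z + l = (z or l) + (z and l), and for a negated literal
    -- z + (not z or l) = (z or not l) + l.
    slack-value : Bool → Bool → Bool → Bool
    slack-value true  z l = not z ∨ l
    slack-value false z l = z ∧ l

    -- The truth values on the layer s; the layer true is the dummy one.
    truth : Var → ℤ → ℤ → Bool → Bool
    truth ⊤ᵛ          a b s = true
    truth layerᵛ      a b s = s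
    truth (var i)     a b s = g i a b
    truth (orᵛ c j)   a b s = s ∨ or c j a b
    truth (pinᵛ c j)  a b s = s ∨ not (or c j a b)
    truth (slack c i) a b s = slack-value (forbidden c i) (s ∨ or c (suc i) a b) (g i a b)

    x : Var → D → Bool
    x v (a , b , t , s) = truth v a b s xor t

    open Build x

    flip : ∀ v X → x v (X -ᴰ tᴰ) ≡ not (x v X)
    flip v (a , b , t , s) = trans (cong (x v) (minus-t a b t s)) (xor-not (truth v a b s) t)
      where
      xor-not : ∀ p q → p xor not q ≡ not (p xor q)
      xor-not false q = refl
      xor-not true  q = refl

    solves-constant : ∀ p q r s → (∀ X → balanceᵇ (x p X) (x q X) (x r X) (x s X) ≡ 0F) → All (Solves x) (constant p q r s)
    solves-constant p q r s zero-sum = eq e₁ ∷ eq e₂ ∷ eq tᴰ ∷ eq sᴰ ∷ []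
      where
      eq : ∀ h X → balanceᵇ (x p (X -ᴰ h)) (x q (X -ᴰ h)) (x r (X -ᴰ h)) (x s (X -ᴰ h)) ≡ balanceᵇ (x p X) (x q X) (x r X) (x s X)
      eq h X = trans (zero-sum (X -ᴰ h)) (sym (zero-sum X))

    balanceᵇ-cong : ∀ {p p′ q q′ r r′ s s′ z} → p ≡ p′ → q ≡ q′ → r ≡ r′ → s ≡ s′ → balanceᵇ p′ q′ r′ s′ ≡ z → balanceᵇ p q r s ≡ z
    balanceᵇ-cong refl refl refl refl e = e

    or-first : ∀ c a b → or c zero a b ≡ true
    or-first c a b = let i , v = avoids c a b in orFrom-first (violation c a b) i (differ _ _ v)
      where
      differ : ∀ p q → p ≢ q → p xor q ≡ true
      differ true  true  n = ⊥-elim (n refl)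
      differ true  false n = refl
      differ false true  n = refl
      differ false false n = ⊥-elim (n refl)

    solves-step : ∀ c i f → forbidden c i ≡ f → All (Solves x) (stepᵇ f c i)
    solves-step c i true eq = solves-constant (orᵛ c (suc i)) (slack c i) (orᵛ c (inject₁ i)) (var i) λ { (a , b , t , s) → balanceᵇ-cong refl
      (cong (λ f → slack-value f (s ∨ or c (suc i) a b) (g i a b) xor t) eq)
      (cong (λ o → (s ∨ o) xor t) (trans (orFrom-step (violation c a b) i) (cong (λ f → (g i a b xor f) ∨ or c (suc i) a b) eq)))
      refl (step⁻-complete s (or c (suc i) a b) (g i a b) t) }
    solves-step c i false eq = solves-constant (orᵛ c (suc i)) (var i) (orᵛ c (inject₁ i)) (slack c i) λ { (a , b , t , s) → balanceᵇ-cong refl refl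
      (cong (λ o → (s ∨ o) xor t) (trans (orFrom-step (violation c a b) i) (cong (λ f → (g i a b xor f) ∨ or c (suc i) a b) eq)))
      (cong (λ f → slack-value f (s ∨ or c (suc i) a b) (g i a b) xor t) eq)
      (step⁺-complete s (or c (suc i) a b) (g i a b) t) }

    solves-clause : ∀ c → All (Solves x) (clause c)
    solves-clause c = ++⁺ (each⁺ (ℕ.suc k) λ j → solves-constant layerᵛ ⊤ᵛ (orᵛ c j) (pinᵛ c j) λ { (a , b , t , s) → pin-complete s (or c j a b) t })
      (++⁺ (solves-constant (orᵛ c (fromℕ k)) ⊤ᵛ layerᵛ ⊤ᵛ λ { (a , b , t , s) →
             balanceᵇ-cong (cong (λ o → (s ∨ o) xor t) (orFrom-last (violation c a b))) refl refl refl (start-complete s t) })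
      (++⁺ (each⁺ k λ i → solves-step c i (forbidden c i) refl)
           (solves-constant (orᵛ c zero) ⊤ᵛ ⊤ᵛ ⊤ᵛ λ { (a , b , t , s) →
             balanceᵇ-cong (cong (λ o → (s ∨ o) xor t) (or-first c a b)) refl refl refl (final-complete s t) })))

    solves-references : All (Solves x) references
    solves-references =
      (λ X → cong val (cong (true xor_) (xor-identityʳ _))) ∷
      (λ X → cong val (cong (true xor_) (xor-identityʳ _))) ∷
      (λ X → cong val (cong (true xor_) (xor-identityʳ _))) ∷
      (λ { (a , b , t , s) → cong val (cong₂ _xor_ (xor-identityʳ s) (xor-identityʳ t)) }) ∷
      (λ { (a , b , t , s) → cong val (cong₂ _xor_ (xor-identityʳ s) (xor-identityʳ t)) }) ∷
      (λ { (a , b , t , s) → cong val (both s t) }) ∷ []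
      where
      both : ∀ s t → (s xor true) xor (t xor true) ≡ s xor t
      both s t = trans (cong₂ _xor_ (xor-comm s true) (xor-comm t true)) (xor-annihilates-not s t)

    solves-along : ∀ i d → (let (v , w , ε) = d in ∀ a b → g i (a ℤ.- v) (b ℤ.- w) ≡ g i a b xor ε) → Solves x (along i d)
    solves-along i (v , w , ε) dir (a , b , t , s) = cong val (trans (cong (_xor (t xor ε)) (dir a b)) (cancel (g i a b) ε t))
      where
      cancel : ∀ p ε t → (p xor ε) xor (t xor ε) ≡ p xor t
      cancel = from-yes (allᵇ? λ p → allᵇ? λ ε → allᵇ? λ t → (p xor ε) xor (t xor ε) ≟ᵇ p xor t)

    solves : All (Solves x) constraints
    solves = ++⁺ (each⁺ K λ i → tt ∷ tt ∷ tt ∷ tt ∷ []) (++⁺ solves-references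
      (++⁺ (each⁺ k λ i → map⁺ (All.map (λ {d} → solves-along i d) (directional i))) (each⁺ N solves-clause)))

    tiling : All (Tiles (graph f)) tiles
    tiling = Tiles-whole ∷ map⁺ (All.map (λ {c} → Tiles-constraint c flip) solves)

  tiles-nonempty : All NonEmpty tiles
  tiles-nonempty = (pt 0ᴰ R.ε , ∈-tile⁺ whole (here refl) refl) ∷ map⁺ (All.universal nonempty constraints)
    where
    module R = Laws R
    ε≡ : R.ε R.∙ (R.ε R.⁻¹) ≡ R.ε
    ε≡ = R.∙-inverseʳ R.ε
    coord-ε : ∀ v → coord v R.ε ≡ 0F
    coord-ε v = trans (cong (coord v) (sym ε≡)) (trans (coord-⊟ v R.ε R.ε) (⊟-self _))
    nonempty : ∀ c → NonEmpty (tile (pieces c))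
    nonempty (opposite v) = pt 0ᴰ R.ε , ∈-tile⁺ (pieces (opposite v)) (here refl) (cong even (coord-ε v))
    nonempty (range v h)  = pt 0ᴰ R.ε , ∈-tile⁺ (pieces (range v h)) (here refl) (cong (is 0F) (coord-ε v))
    nonempty (inv φ h)    = pt 0ᴰ R.ε , ∈-tile⁺ (pieces (inv φ h)) (here refl)
      (cong (is 0F) (trans (cong (eval φ) (sym ε≡)) (trans (eval-⊟ φ R.ε R.ε) (⊟-self _))))

-- Residues modulo 8

infixl 6 _+₈_ _-₈_

opaque
  _+₈_ : Fin 8 → Fin 8 → Fin 8
  d +₈ e = (toℕ d ℕ.+ toℕ e) mod 8

  _-₈_ : Fin 8 → Fin 8 → Fin 8
  d -₈ e = (toℕ d ℕ.+ (8 ℕ.∸ toℕ e)) mod 8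

  _*₈_ : Fin 8 → Fin 8 → Fin 8
  d *₈ e = (toℕ d ℕ.* toℕ e) mod 8

odd : Fin 8 → Bool
odd 0F = false
odd 1F = true
odd 2F = false
odd 3F = true
odd 4F = false
odd 5F = true
odd 6F = false
odd 7F = true

opaque
  unfolding _+₈_ _-₈_ _*₈_

  +₈-carry : ∀ d e → toℕ d ℕ.+ toℕ e ≡ toℕ (d +₈ e) ℕ.+ ((toℕ d ℕ.+ toℕ e) ℕ./ 8) ℕ.* 8
  +₈-carry = from-yes (all? λ d → all? λ e →
    toℕ d ℕ.+ toℕ e ℕ.≟ toℕ (d +₈ e) ℕ.+ ((toℕ d ℕ.+ toℕ e) ℕ./ 8) ℕ.* 8)

  +₈-identityˡ : ∀ d → 0F +₈ d ≡ d
  +₈-identityˡ = from-yes (all? λ d → 0F +₈ d Fin.≟ d)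

  +₈-identityʳ : ∀ d → d +₈ 0F ≡ d
  +₈-identityʳ = from-yes (all? λ d → d +₈ 0F Fin.≟ d)

  +₈-idem : ∀ d → d +₈ d ≡ d → d ≡ 0F
  +₈-idem = from-yes (all? λ d → d +₈ d Fin.≟ d →-dec d Fin.≟ 0F)

  +₈-cancelʳ : ∀ d e → d +₈ e ≡ e → d ≡ 0F
  +₈-cancelʳ = from-yes (all? λ d → all? λ e → d +₈ e Fin.≟ e →-dec d Fin.≟ 0F)

  +₈-cancelˡ : ∀ d e → d +₈ e ≡ d → e ≡ 0F
  +₈-cancelˡ = from-yes (all? λ d → all? λ e → d +₈ e Fin.≟ d →-dec e Fin.≟ 0F)

  -₈-self : ∀ d → d -₈ d ≡ 0F
  -₈-self = from-yes (all? λ d → d -₈ d Fin.≟ 0F)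

  -₈-+₈ : ∀ d e → (d -₈ e) +₈ e ≡ d
  -₈-+₈ = from-yes (all? λ d → all? λ e → (d -₈ e) +₈ e Fin.≟ d)

  +₈-₈ : ∀ d e → (d +₈ e) -₈ e ≡ d
  +₈-₈ = from-yes (all? λ d → all? λ e → (d +₈ e) -₈ e Fin.≟ d)

  -₈-0 : ∀ d e → d -₈ e ≡ 0F → d ≡ e
  -₈-0 = from-yes (all? λ d → all? λ e → d -₈ e Fin.≟ 0F →-dec d Fin.≟ e)

  -₈-≡ : ∀ c d e → c -₈ d ≡ c -₈ e → d ≡ e
  -₈-≡ = from-yes (all? λ c → all? λ d → all? λ e → c -₈ d Fin.≟ c -₈ e →-dec d Fin.≟ e)

  -₈--₈ : ∀ d u → d -₈ (d -₈ u) ≡ u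
  -₈--₈ = from-yes (all? λ d → all? λ u → d -₈ (d -₈ u) Fin.≟ u)

  telescope : ∀ d h e → (d -₈ h) +₈ (e -₈ d) ≡ e -₈ h
  telescope = from-yes (all? λ d → all? λ h → all? λ e → (d -₈ h) +₈ (e -₈ d) Fin.≟ e -₈ h)

  +₈-cancel-both : ∀ a b c d → (a +₈ b) -₈ (c +₈ d) ≡ (a -₈ c) +₈ (b -₈ d)
  +₈-cancel-both = from-yes (all? λ a → all? λ b → all? λ c → all? λ d → (a +₈ b) -₈ (c +₈ d) Fin.≟ (a -₈ c) +₈ (b -₈ d))

  +₈-difference : ∀ u w q z → ((u +₈ ((w +₈ q) -₈ z)) -₈ q) -₈ z ≡ (u -₈ z) +₈ (w -₈ z)
  +₈-difference = from-yes (all? λ u → all? λ w → all? λ q → all? λ z →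
    ((u +₈ ((w +₈ q) -₈ z)) -₈ q) -₈ z Fin.≟ (u -₈ z) +₈ (w -₈ z))

  +₈-comm : ∀ d e → d +₈ e ≡ e +₈ d
  +₈-comm = from-yes (all? λ d → all? λ e → d +₈ e Fin.≟ e +₈ d)

  +₈-exchange : ∀ d e z → (d +₈ e) -₈ z ≡ (d -₈ z) +₈ e
  +₈-exchange = from-yes (all? λ d → all? λ e → all? λ z → (d +₈ e) -₈ z Fin.≟ (d -₈ z) +₈ e)

  +₈-shift : ∀ d z → (d +₈ (0F -₈ z)) +₈ z ≡ d
  +₈-shift = from-yes (all? λ d → all? λ z → (d +₈ (0F -₈ z)) +₈ z Fin.≟ d)

  odd-+₈-1 : ∀ d → odd (d +₈ 1F) ≡ not (odd d)
  odd-+₈-1 = from-yes (all? λ d → odd (d +₈ 1F) ≟ᵇ not (odd d))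

  *₈-distribˡ : ∀ a d e → a *₈ (d +₈ e) ≡ (a *₈ d) +₈ (a *₈ e)
  *₈-distribˡ = from-yes (all? λ a → all? λ d → all? λ e → a *₈ (d +₈ e) Fin.≟ (a *₈ d) +₈ (a *₈ e))

  *₈-identityʳ : ∀ a → a *₈ 1F ≡ a
  *₈-identityʳ = from-yes (all? λ a → a *₈ 1F Fin.≟ a)

  *₈-zeroʳ : ∀ a → a *₈ 0F ≡ 0F
  *₈-zeroʳ = from-yes (all? λ a → a *₈ 0F Fin.≟ 0F)

  odd-unit : ∀ a → odd a ≡ true → ∀ d → a *₈ (a *₈ d) ≡ d
  odd-unit = from-yes (all? λ a → odd a ≟ᵇ true →-dec all? λ d → a *₈ (a *₈ d) Fin.≟ d)

  odd-difference : ∀ d e → odd e ≡ not (odd d) → odd (d -₈ e) ≡ true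
  odd-difference = from-yes (all? λ d → all? λ e → odd e ≟ᵇ not (odd d) →-dec odd (d -₈ e) ≟ᵇ true)

  -- Four excluded values leave one of the five candidates 0 to 4.
  fresh : ∀ (a b c d : Fin 8) → ∃ λ (e : Fin 8) → e ≢ a × e ≢ b × e ≢ c × e ≢ d
  fresh a b c d = first a b c d , first-≢ a b c d
    where
    first : (a b c d : Fin 8) → Fin 8
    first a b c d = if outside 0F then 0F else if outside 1F then 1F else if outside 2F then 2F else
      if outside 3F then 3F else 4F
      where
      outside : Fin 8 → Bool
      outside e = not (does (e Fin.≟ a) ∨ does (e Fin.≟ b) ∨ does (e Fin.≟ c) ∨ does (e Fin.≟ d))
    first-≢ : ∀ (a b c d : Fin 8) → first a b c d ≢ a × first a b c d ≢ b × first a b c d ≢ c × first a b c d ≢ d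
    first-≢ = from-yes (all? λ a → all? λ b → all? λ c → all? λ d → let e = first a b c d in
      ¬? (e Fin.≟ a) ×-dec ¬? (e Fin.≟ b) ×-dec ¬? (e Fin.≟ c) ×-dec ¬? (e Fin.≟ d))

  split : ∀ e c → e ≡ 0F ⊎ c ≡ e ⊎ (∃ λ d → d ≢ 0F × e -₈ d ≢ 0F × c ≢ d × c ≢ e -₈ d × d +₈ (e -₈ d) ≡ e)
  split = from-yes (all? λ e → all? λ c → e Fin.≟ 0F ⊎-dec c Fin.≟ e ⊎-dec any? λ d →
    ¬? (d Fin.≟ 0F) ×-dec ¬? (e -₈ d Fin.≟ 0F) ×-dec ¬? (c Fin.≟ d) ×-dec ¬? (c Fin.≟ e -₈ d) ×-dec d +₈ (e -₈ d) Fin.≟ e)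

-- The references of an arbitrary solution give the residue map only up to a unit of ℤ/8, so the
-- descent works with every such map.
record Residue (ρ : ℤ → Fin 8) : Set where
  field
    hom      : ∀ x y → ρ (x + y) ≡ ρ x +₈ ρ y
    kernel   : ∀ x → ρ x ≡ 0F → ∃ λ m → x ≡ m * + 8
    multiple : ∀ m → ρ (m * + 8) ≡ 0F
    onto     : ∀ d → ∃ λ x → ρ x ≡ d

  minus : ∀ x y → ρ (x - y) ≡ ρ x -₈ ρ y
  minus x y = trans (sym (+₈-₈ (ρ (x - y)) (ρ y))) (cong (_-₈ ρ y) (trans (sym (hom (x - y) y)) (cong ρ (restore x y))))
    where
    restore : ∀ x y → x - y + y ≡ x
    restore = solve-∀

  avoiding : ∀ a b c d → ∃ λ z → ρ z ≢ a × ρ z ≢ b × ρ z ≢ c × ρ z ≢ d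
  avoiding a b c d = let e , n₁ , n₂ , n₃ , n₄ = fresh a b c d ; z , p = onto e in
    z , (λ q → n₁ (trans (sym p) q)) , (λ q → n₂ (trans (sym p) q)) , (λ q → n₃ (trans (sym p) q)) , (λ q → n₄ (trans (sym p) q))

  drop : ∀ m y → ρ (m * + 8 + y) ≡ ρ y
  drop m y = trans (hom (m * + 8) y) (trans (cong (_+₈ ρ y) (multiple m)) (+₈-identityˡ (ρ y)))

  drop′ : ∀ x m → ρ (x + m * + 8) ≡ ρ x
  drop′ x m = trans (hom x (m * + 8)) (trans (cong (ρ x +₈_) (multiple m)) (+₈-identityʳ (ρ x)))

opaque
  res : ℤ → Fin 8
  res x = fromℕ< (n%ℕd<d x 8)

  res-form : ∀ x → x ≡ + toℕ (res x) + (x /ℕ 8) * + 8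
  res-form x = trans (a≡a%ℕn+[a/ℕn]*n x 8) (cong (λ r → + r + (x /ℕ 8) * + 8) (sym (toℕ-fromℕ< (n%ℕd<d x 8))))

  res-0 : res (+ 0) ≡ 0F
  res-0 = refl

  res-1 : res (+ 1) ≡ 1F
  res-1 = refl

remainder-unique : ∀ (i j : Fin 8) p q → + toℕ i + p * + 8 ≡ + toℕ j + q * + 8 → i ≡ j
remainder-unique i j p q eq = small i j (ℕ.divides ∣ q - p ∣ (trans (cong ∣_∣ difference) (ℤ.abs-* (q - p) (+ 8))))
  where
  rearrange : ∀ a b p → a - b ≡ (a + p * + 8) - b - p * + 8
  rearrange = solve-∀
  collect : ∀ b p q → (b + q * + 8) - b - p * + 8 ≡ (q - p) * + 8
  collect = solve-∀
  difference : + toℕ i - + toℕ j ≡ (q - p) * + 8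
  difference = trans (rearrange (+ toℕ i) (+ toℕ j) p)
    (trans (cong (λ z → z - + toℕ j - p * + 8) eq) (collect (+ toℕ j) p q))
  small : ∀ (i j : Fin 8) → 8 ℕ.∣ ∣ + toℕ i - + toℕ j ∣ → i ≡ j
  small = from-yes (all? λ (i : Fin 8) → all? λ (j : Fin 8) → (8 ℕ.∣? ∣ + toℕ i - + toℕ j ∣) →-dec i Fin.≟ j)

res-unique : ∀ (i : Fin 8) q → res (+ toℕ i + q * + 8) ≡ i
res-unique i q = remainder-unique (res x) i (x /ℕ 8) q (sym (res-form x))
  where
  x : ℤ
  x = + toℕ i + q * + 8

res-residue : Residue res
res-residue = record
  { hom      = λ x y → trans (cong res (sum x y)) (res-unique (res x +₈ res y) (carry x y))
  ; kernel   = λ x e → x /ℕ 8 , trans (res-form x) (trans (cong (λ r → + toℕ r + (x /ℕ 8) * + 8) e) (ℤ.+-identityˡ _))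
  ; multiple = λ m → trans (cong res (sym (ℤ.+-identityˡ (m * + 8)))) (res-unique 0F m)
  ; onto     = λ d → + toℕ d , trans (cong res (sym (ℤ.+-identityʳ (+ toℕ d)))) (res-unique d (+ 0)) }
  where
  regroup : ∀ a b p q → (a + p * + 8) + (b + q * + 8) ≡ (a + b) + (p + q) * + 8
  regroup = solve-∀
  regroup′ : ∀ a c p → (a + c * + 8) + p * + 8 ≡ a + (c + p) * + 8
  regroup′ = solve-∀
  carry : ℤ → ℤ → ℤ
  carry x y = + ((toℕ (res x) ℕ.+ toℕ (res y)) ℕ./ 8) + (x /ℕ 8 + y /ℕ 8)
  sum : ∀ x y → x + y ≡ + toℕ (res x +₈ res y) + carry x y * + 8
  sum x y = trans (cong₂ _+_ (res-form x) (res-form y)) (trans (regroup (+ toℕ (res x)) (+ toℕ (res y)) (x /ℕ 8) (y /ℕ 8))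
    (trans (cong (λ z → z + (x /ℕ 8 + y /ℕ 8) * + 8) (trans (cong +_ (+₈-carry (res x) (res y)))
      (cong (λ z → + toℕ (res x +₈ res y) + z) (ℤ.pos-* ((toℕ (res x) ℕ.+ toℕ (res y)) ℕ./ 8) 8))))
    (regroup′ (+ toℕ (res x +₈ res y)) (+ ((toℕ (res x) ℕ.+ toℕ (res y)) ℕ./ 8)) (x /ℕ 8 + y /ℕ 8))))

-- A homomorphism ℤ → ℤ/8 that is odd at 1 is a unit multiple of the residue map.
odd-residue : ∀ ρ → (∀ x y → ρ (x + y) ≡ ρ x +₈ ρ y) → odd (ρ (+ 1)) ≡ true → Residue ρ
odd-residue ρ hom o = record
  { hom      = hom
  -- The square of an odd number is 1 modulo 8, so multiplication by α is its own inverse.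
  ; kernel   = λ x e → Residue.kernel res-residue x
      (trans (sym (odd-unit α o (res x))) (trans (cong (α *₈_) (trans (sym (ρ≡ x)) e)) (*₈-zeroʳ α)))
  ; multiple = λ m → trans (ρ≡ (m * + 8)) (trans (cong (α *₈_) (Residue.multiple res-residue m)) (*₈-zeroʳ α))
  ; onto     = λ d → let x , e = Residue.onto res-residue (α *₈ d) in
      x , trans (ρ≡ x) (trans (cong (α *₈_) e) (odd-unit α o d)) }
  where
  α = ρ (+ 1)
  restore : ∀ z → z - + 1 + + 1 ≡ z
  restore = solve-∀
  step : ∀ z → ρ (z - + 1) -₈ α *₈ res (z - + 1) ≡ ρ z -₈ α *₈ res z
  step z = sym (trans (cong₂ (λ p q → p -₈ α *₈ q)
      (trans (cong ρ (sym (restore z))) (hom (z - + 1) (+ 1)))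
      (trans (cong res (sym (restore z))) (trans (Residue.hom res-residue (z - + 1) (+ 1)) (cong (res (z - + 1) +₈_) res-1))))
    (trans (cong (λ w → (ρ (z - + 1) +₈ α) -₈ w) (trans (*₈-distribˡ α (res (z - + 1)) 1F) (cong (α *₈ res (z - + 1) +₈_) (*₈-identityʳ α))))
    (trans (+₈-cancel-both (ρ (z - + 1)) α (α *₈ res (z - + 1)) α)
    (trans (cong ((ρ (z - + 1) -₈ α *₈ res (z - + 1)) +₈_) (-₈-self α)) (+₈-identityʳ _)))))
  ρ≡ : ∀ x → ρ x ≡ α *₈ res x
  ρ≡ x = -₈-0 _ _ (trans (ℤ-constant (λ z → ρ z -₈ α *₈ res z) step x)
    (trans (cong₂ _-₈_ (+₈-idem _ (sym (hom (+ 0) (+ 0)))) (trans (cong (α *₈_) res-0) (*₈-zeroʳ α))) (-₈-self 0F)))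

-- The last nonzero digit in base 8

-- The first argument is fuel. The amount ∣ x ∣ suffices, because dividing a nonzero multiple of 8
-- by 8 lowers its absolute value.
digitWithin : ℕ → ℤ → Fin 8
digitWithin ℕ.zero    x = 1F
digitWithin (ℕ.suc n) x with res x
... | 0F      = digitWithin n (x /ℕ 8)
... | suc d   = suc d

digitWithin-res : ∀ n x → res x ≢ 0F → digitWithin (ℕ.suc n) x ≡ res x
digitWithin-res n x p with res x
... | 0F    = ⊥-elim (p refl)
... | suc d = refl

digitWithin-quotient : ∀ n x → res x ≡ 0F → digitWithin (ℕ.suc n) x ≡ digitWithin n (x /ℕ 8)
digitWithin-quotient n x e with res x
digitWithin-quotient n x refl | 0F = refl

shrink : ∀ m {n} → m ℕ.* 8 ℕ.≤ ℕ.suc n → m ℕ.≤ n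
shrink ℕ.zero    le = ℕ.z≤n
shrink m@(ℕ.suc _) le = ℕ.s≤s⁻¹ (ℕ.≤-trans (ℕ.m<m*n m 8 (ℕ.s≤s (ℕ.s≤s ℕ.z≤n))) le)

quotient : ∀ x → res x ≡ 0F → x ≡ (x /ℕ 8) * + 8
quotient x e = trans (res-form x) (trans (cong (λ r → + toℕ r + (x /ℕ 8) * + 8) e) (ℤ.+-identityˡ _))

quotient-≤ : ∀ x {n} → res x ≡ 0F → ∣ x ∣ ℕ.≤ ℕ.suc n → ∣ x /ℕ 8 ∣ ℕ.≤ n
quotient-≤ x e le = shrink _ (ℕ.≤-trans (ℕ.≤-reflexive (trans (sym (ℤ.abs-* (x /ℕ 8) (+ 8))) (cong ∣_∣ (sym (quotient x e))))) le)

digitWithin-0 : ∀ n → digitWithin n (+ 0) ≡ 1F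
digitWithin-0 ℕ.zero    = refl
digitWithin-0 (ℕ.suc n) = trans (digitWithin-quotient n (+ 0) res-0) (digitWithin-0 n)

digitWithin-fuel : ∀ m n x → ∣ x ∣ ℕ.≤ m → ∣ x ∣ ℕ.≤ n → digitWithin m x ≡ digitWithin n x
digitWithin-fuel ℕ.zero n (+ ℕ.zero) le le′ = sym (digitWithin-0 n)
digitWithin-fuel (ℕ.suc m) ℕ.zero (+ ℕ.zero) le le′ = digitWithin-0 (ℕ.suc m)
digitWithin-fuel (ℕ.suc m) (ℕ.suc n) x le le′ with res x in eq
... | 0F    = digitWithin-fuel m n (x /ℕ 8) (quotient-≤ x eq le) (quotient-≤ x eq le′)
... | suc d = refl

digitWithin-8 : ∀ m x → x ≡ m * + 8 → (digitWithin ∣ x ∣ x) ≡ (digitWithin ∣ m ∣ m)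
digitWithin-8 m x eq = trans (digitWithin-fuel ∣ x ∣ (ℕ.suc ∣ x ∣) x ℕ.≤-refl (ℕ.n≤1+n ∣ x ∣))
  (trans (digitWithin-quotient ∣ x ∣ x e)
  (trans (cong (digitWithin ∣ x ∣) (ℤ.*-cancelʳ-≡ (x /ℕ 8) m (+ 8) (trans (sym (quotient x e)) eq)))
  (digitWithin-fuel ∣ x ∣ ∣ m ∣ m
    (ℕ.≤-trans (ℕ.m≤m*n ∣ m ∣ 8) (ℕ.≤-reflexive (trans (sym (ℤ.abs-* m (+ 8))) (cong ∣_∣ (sym eq))))) ℕ.≤-refl)))
  where
  e : res x ≡ 0F
  e = trans (cong res eq) (Residue.multiple res-residue m)

opaque
  -- At 0, which has no nonzero digit, the value is 1.
  digit : ℤ → Fin 8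
  digit x = digitWithin ∣ x ∣ x

  digit-res : ∀ x → res x ≢ 0F → digit x ≡ res x
  digit-res (+ ℕ.zero)      n = ⊥-elim (n res-0)
  digit-res x@(+ ℕ.suc m)   n = digitWithin-res m x n
  digit-res x@(-[1+ m ])    n = digitWithin-res m x n

  digit-8 : ∀ m → digit (m * + 8) ≡ digit m
  digit-8 m = digitWithin-8 m (m * + 8) refl

-- Sums of digits

-- If y and x + y have the same last digit k, then a higher power of 8 divides x than y, or one of
-- the last two alternatives of Shift holds anyway.  In the first case the digits of x and x + 8 y
-- differ by k, unless one of the two comes from a deeper level.
Shift : Fin 8 → Fin 8 → Fin 8 → Set
Shift k u w = w ≡ u +₈ k ⊎ w ≡ k ⊎ u +₈ k ≡ 0F

-- If the last nonzero digits of x and y stand at the same place they add up, unless their sum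
-- vanishes and a higher place decides. If they stand at different places, the lower one survives.
Sum : Fin 8 → Fin 8 → Fin 8 → Set
Sum a b c = c ≡ a +₈ b ⊎ c ≡ a ⊎ c ≡ b ⊎ a +₈ b ≡ 0F

Shift? : ∀ k u w → Dec (Shift k u w)
Shift? k u w = w Fin.≟ u +₈ k ⊎-dec w Fin.≟ k ⊎-dec u +₈ k Fin.≟ 0F

Sum? : ∀ a b c → Dec (Sum a b c)
Sum? a b c = c Fin.≟ a +₈ b ⊎-dec c Fin.≟ a ⊎-dec c Fin.≟ b ⊎-dec a +₈ b Fin.≟ 0F

-- If c differs from e and e is not 0, some decomposition of e into nonzero parts d and e - d avoids
-- c, and for it every alternative of `Sum` fails.
sum-unique : ∀ e c → e ≢ 0F → (∀ d → d ≢ 0F → e -₈ d ≢ 0F → Sum d (e -₈ d) c) → c ≡ e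
sum-unique e c n sums with split e c
... | inj₁ p = ⊥-elim (n p)
... | inj₂ (inj₁ p) = p
... | inj₂ (inj₂ (d , d≢0 , e≢0 , c≢d , c≢e , d+e)) with sums d d≢0 e≢0
... | inj₁ p = trans p d+e
... | inj₂ (inj₁ p) = ⊥-elim (c≢d p)
... | inj₂ (inj₂ (inj₁ p)) = ⊥-elim (c≢e p)
... | inj₂ (inj₂ (inj₂ p)) = ⊥-elim (n (trans (sym d+e) p))

8-induction : (P : ℤ → ℤ → Set) → P (+ 0) (+ 0) → (∀ x y → res x ≢ 0F ⊎ res y ≢ 0F → P x y) →
  (∀ x y → P x y → P (x * + 8) (y * + 8)) → ∀ x y → P x y
8-induction P base prim step x y = go (∣ x ∣ ℕ.+ ∣ y ∣) x y ℕ.≤-refl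
  where
  go : ∀ n x y → ∣ x ∣ ℕ.+ ∣ y ∣ ℕ.≤ n → P x y
  go ℕ.zero (+ ℕ.zero) (+ ℕ.zero) le = base
  go (ℕ.suc n) x y le with res x Fin.≟ 0F | res y Fin.≟ 0F
  ... | no p  | _     = prim x y (inj₁ p)
  ... | yes _ | no q  = prim x y (inj₂ q)
  ... | yes p | yes q = subst₂ P (sym (quotient x p)) (sym (quotient y q)) (step _ _ (go n (x /ℕ 8) (y /ℕ 8)
    (shrink _ (ℕ.≤-trans (ℕ.≤-reflexive (sym total)) le))))
    where
    total : ∣ x ∣ ℕ.+ ∣ y ∣ ≡ (∣ x /ℕ 8 ∣ ℕ.+ ∣ y /ℕ 8 ∣) ℕ.* 8
    total = trans (cong₂ ℕ._+_ (trans (cong ∣_∣ (quotient x p)) (ℤ.abs-* (x /ℕ 8) (+ 8))) (trans (cong ∣_∣ (quotient y q)) (ℤ.abs-* (y /ℕ 8) (+ 8))))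
      (sym (ℕ.*-distribʳ-+ 8 ∣ x /ℕ 8 ∣ ∣ y /ℕ 8 ∣))

module _ where
  open Residue res-residue

  digit-sum : ∀ x y → Sum (digit x) (digit y) (digit (x + y))
  digit-sum = 8-induction _ (inj₂ (inj₁ refl)) (λ x y → prim x y (res x Fin.≟ 0F) (res y Fin.≟ 0F)) step
    where
    step : ∀ x y → Sum (digit x) (digit y) (digit (x + y)) → Sum (digit (x * + 8)) (digit (y * + 8)) (digit (x * + 8 + y * + 8))
    step x y p rewrite digit-8 x | digit-8 y | sym (ℤ.*-distribʳ-+ (+ 8) x y) | digit-8 (x + y) = p
    at : ∀ z {d} → res z ≡ d → d ≢ 0F → digit z ≡ d
    at z refl n = digit-res z n
    prim : ∀ x y → Dec (res x ≡ 0F) → Dec (res y ≡ 0F) → res x ≢ 0F ⊎ res y ≢ 0F → Sum (digit x) (digit y) (digit (x + y))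
    prim x y (yes p) (yes q) n = ⊥-elim ([ (λ f → f p) , (λ f → f q) ]′ n)
    prim x y (yes p) (no q)  n = inj₂ (inj₂ (inj₁ (trans (at (x + y) (trans (hom x y) (trans (cong (_+₈ res y) p) (+₈-identityˡ _))) q) (sym (digit-res y q)))))
    prim x y (no p)  (yes q) n = inj₂ (inj₁ (trans (at (x + y) (trans (hom x y) (trans (cong (res x +₈_) q) (+₈-identityʳ _))) p) (sym (digit-res x p))))
    prim x y (no p)  (no q)  n rewrite digit-res x p | digit-res y q with res (x + y) Fin.≟ 0F
    ... | yes r = inj₂ (inj₂ (inj₂ (trans (sym (hom x y)) r)))
    ... | no r  = inj₁ (trans (digit-res (x + y) r) (hom x y))

  digit-shift : ∀ x y → digit y ≡ digit (x + y) → Shift (digit y) (digit x) (digit (x + y * + 8))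
  digit-shift = 8-induction _ (λ _ → inj₂ (inj₁ refl)) (λ x y → prim x y (res x Fin.≟ 0F) (res y Fin.≟ 0F)) step
    where
    P : ℤ → ℤ → Set
    P x y = digit y ≡ digit (x + y) → Shift (digit y) (digit x) (digit (x + y * + 8))
    step : ∀ x y → P x y → P (x * + 8) (y * + 8)
    step x y p rewrite digit-8 x | digit-8 y | sym (ℤ.*-distribʳ-+ (+ 8) x y) | digit-8 (x + y)
      | sym (ℤ.*-distribʳ-+ (+ 8) x (y * + 8)) | digit-8 (x + y * + 8) = p
    at : ∀ z {d} → res z ≡ d → d ≢ 0F → digit z ≡ d
    at z refl n = digit-res z n
    prim : ∀ x y → Dec (res x ≡ 0F) → Dec (res y ≡ 0F) → res x ≢ 0F ⊎ res y ≢ 0F → P x y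
    prim x y (yes p) (yes q) n e = ⊥-elim ([ (λ f → f p) , (λ f → f q) ]′ n)
    prim x y (no p) (yes q) n e = inj₂ (inj₁ (trans (trans (at (x + y * + 8) (drop′ x y) p)
      (sym (at (x + y) (trans (hom x y) (trans (cong (res x +₈_) q) (+₈-identityʳ _))) p))) (sym e)))
    prim x y (no p) (no q) n e rewrite digit-res x p | digit-res y q with res (x + y) Fin.≟ 0F
    ... | yes r = inj₂ (inj₂ (trans (sym (hom x y)) r))
    ... | no r  = ⊥-elim (p (+₈-cancelʳ (res x) (res y) (trans (sym (hom x y)) (trans (sym (digit-res (x + y) r)) (sym e)))))
    -- The case the rule is made for: with x = 8 m, both x and x + 8 y are multiples of 8, and the
    -- rule becomes a statement about the digits of m and m + y.
    prim x y (yes p) (no q) n e with kernel x p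
    ... | m , refl rewrite digit-8 m | sym (ℤ.*-distribʳ-+ (+ 8) m y) | digit-8 (m + y) | digit-res y q
      with res m Fin.≟ 0F
    ... | yes r = inj₂ (inj₁ (at (m + y) (trans (hom m y) (trans (cong (_+₈ res y) r) (+₈-identityˡ _))) q))
    ... | no r rewrite digit-res m r with res (m + y) Fin.≟ 0F
    ... | yes s = inj₂ (inj₂ (trans (sym (hom m y)) s))
    ... | no s  = inj₁ (trans (digit-res (m + y) s) (hom m y))

-- Rigidity and descent

module Descent (ρ : ℤ → Fin 8) (residue : Residue ρ) where
  open Residue residue

  -- If U is the residue map up to a shift, then hole is constant, and its value is the residue
  -- class on which U escapes the rule.
  module Rigid (U W : ℤ → Fin 8)
    (shift : ∀ m k → ρ k ≢ 0F → Shift (ρ k) (U m) (W (m + k))) where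

    hole : ℤ → Fin 8
    hole x = ρ x -₈ U x

    U≡ : ∀ x → U x ≡ ρ x -₈ hole x
    U≡ x = sym (-₈--₈ (ρ x) (U x))

    -- Put k = z - x in `shift`. Then U x + ρ k telescopes to ρ z - hole x, so the third alternative
    -- of `Shift` occurs only if ρ z is the hole of x.
    seen-from : ∀ x z → ρ z ≢ ρ x → ρ z ≢ hole x → W z ≡ ρ z -₈ hole x ⊎ W z ≡ ρ z -₈ ρ x
    seen-from x z n₁ n₂ with subst (λ w → Shift (ρ (z - x)) (U x) (W w)) (restore x z) (shift x (z - x) (λ e → n₁ (-₈-0 _ _ (trans (sym (minus z x)) e))))
      where
      restore : ∀ x z → x + (z - x) ≡ z
      restore = solve-∀
    ... | inj₁ e = inj₁ (trans e (trans (cong₂ _+₈_ (U≡ x) (minus z x)) (telescope (ρ x) (hole x) (ρ z))))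
    ... | inj₂ (inj₁ e) = inj₂ (trans e (minus z x))
    ... | inj₂ (inj₂ e) = ⊥-elim (n₂ (-₈-0 _ _ (trans (sym (trans (cong₂ _+₈_ (U≡ x) (minus z x)) (telescope (ρ x) (hole x) (ρ z)))) e)))

    -- Read `W z` from x and from y, at a z outside the four classes where a reading could fail.
    -- Both readings subtract a class from ρ z, so the pairs {ρ x , hole x} and {ρ y , hole y} meet.
    related : ∀ x y → ρ x ≢ ρ y → hole x ≡ hole y ⊎ hole x ≡ ρ y ⊎ hole y ≡ ρ x
    related x y n with avoiding (ρ x) (hole x) (ρ y) (hole y)
    ... | z , n₁ , n₂ , n₃ , n₄ with seen-from x z n₁ n₂ | seen-from y z n₃ n₄
    ... | inj₁ p | inj₁ q = inj₁ (-₈-≡ (ρ z) _ _ (trans (sym p) q))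
    ... | inj₁ p | inj₂ q = inj₂ (inj₁ (-₈-≡ (ρ z) _ _ (trans (sym p) q)))
    ... | inj₂ p | inj₁ q = inj₂ (inj₂ (-₈-≡ (ρ z) _ _ (trans (sym q) p)))
    ... | inj₂ p | inj₂ q = ⊥-elim (n (-₈-≡ (ρ z) _ _ (trans (sym p) q)))

    two-agree : ∀ {h} p q → ρ p ≢ ρ q → hole p ≡ h → hole q ≡ h →
      ∀ x → ρ x ≢ h → ρ x ≢ ρ p → ρ x ≢ ρ q → hole x ≡ h
    two-agree p q n refl hq x xh xp xq with related x p xp | related x q xq
    ... | inj₁ e | _ = e
    ... | inj₂ (inj₂ e) | _ = ⊥-elim (xh (sym e))
    ... | inj₂ (inj₁ e) | inj₁ e′ = trans e′ hq
    ... | inj₂ (inj₁ e) | inj₂ (inj₂ e′) = ⊥-elim (xh (trans (sym e′) hq))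
    ... | inj₂ (inj₁ e) | inj₂ (inj₁ e′) = ⊥-elim (n (trans (sym e) e′))

    -- A point in the class of p or of q is not covered by `two-agree`. A witness r in a third class
    -- replaces the one it collides with.
    all-agree : ∀ {h} p q → ρ p ≢ ρ q → hole p ≡ h → hole q ≡ h → ∀ x → ρ x ≢ h → hole x ≡ h
    all-agree {h} p q n hp hq x xh with avoiding (ρ p) (ρ q) h h
    ... | r , n₁ , n₂ , n₃ , _ with ρ x Fin.≟ ρ p | ρ x Fin.≟ ρ q
    ... | no xp | no xq = two-agree p q n hp hq x xh xp xq
    ... | yes xp | _ = two-agree q r (λ e → n₂ (sym e)) hq hr x xh (λ e → n (trans (sym xp) e)) (λ e → n₁ (trans (sym e) xp))
      where hr = two-agree p q n hp hq r n₃ n₁ n₂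
    ... | no xp | yes xq = two-agree p r (λ e → n₁ (sym e)) hp hr x xh xp (λ e → n₂ (trans (sym e) xq))
      where hr = two-agree p q n hp hq r n₃ n₁ n₂

    -- Pairs that meet pairwise either share an element or lie in a triangle. All eight classes
    -- occur as ρ x, so there is no room for a triangle, and the shared element h is the hole of
    -- every x outside its own class.
    common-hole : ∃ λ h → ∀ x → ρ x ≢ h → hole x ≡ h
    common-hole with avoiding (ρ (+ 0)) (hole (+ 0)) 0F 0F
    ... | p , n₁ , n₂ , _ with related p (+ 0) n₁
    ... | inj₁ e = hole (+ 0) , all-agree p (+ 0) n₁ e refl
    ... | inj₂ (inj₂ e) = ⊥-elim (n₂ (sym e))
    ... | inj₂ (inj₁ e) with avoiding (ρ (+ 0)) (hole (+ 0)) (ρ p) 0F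
    ... | q , m₁ , m₂ , m₃ , _ = ρ (+ 0) , all-agree p q (λ e → m₃ (sym e)) e hq
      where
      hq : hole q ≡ ρ (+ 0)
      hq with related q (+ 0) m₁ | related q p m₃
      ... | inj₂ (inj₁ e₁) | _ = e₁
      ... | inj₂ (inj₂ e₁) | _ = ⊥-elim (m₂ (sym e₁))
      ... | inj₁ e₁ | inj₁ e₂ = trans e₂ e
      ... | inj₁ e₁ | inj₂ (inj₁ e₂) = ⊥-elim (n₂ (trans (sym e₂) e₁))
      ... | inj₁ e₁ | inj₂ (inj₂ e₂) = ⊥-elim (m₁ (trans (sym e₂) e))

    opaque
      offset : ∃ λ H → ∀ m → ρ (m - H) ≢ 0F → U m ≡ ρ (m - H)
      offset = let h , agree = common-hole ; H , e = onto h in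
        H , λ m n → trans (U≡ m) (trans (cong (ρ m -₈_) (trans
          (agree m λ q → n (trans (minus m H) (trans (cong₂ _-₈_ q e) (-₈-self h)))) (sym e))) (sym (minus m H)))

  -- Here a, b, c are read along x, y, x + y, and a*, b* along x + 8 y, y + 8 x. Normality will be
  -- carried along for a, b, c only; a* and b* serve as witnesses.
  record System (a a* b b* c : ℤ → Fin 8) : Set where
    field
      shift-a : ∀ x y → b y ≡ c (x + y) → Shift (b y) (a x) (a* (x + y * + 8))
      shift-b : ∀ x y → a x ≡ c (x + y) → Shift (a x) (b y) (b* (y + x * + 8))
      sum     : ∀ x y → Sum (a x) (b y) (c (x + y))

  Normal : (ℤ → Fin 8) → Set
  Normal a = ∀ x → ρ x ≢ 0F → a x ≡ ρ x

  normal-≡ : ∀ {a} → Normal a → ∀ x {d} → ρ x ≡ d → d ≢ 0F → a x ≡ d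
  normal-≡ N x refl n = N x n

  translate : ∀ {a a* b b* c} → System a a* b b* c → ∀ H K →
    System (λ x → a (x + H)) (λ x → a* (x + H + K * + 8)) (λ y → b (y + K)) (λ y → b* (y + K + H * + 8)) (λ z → c (z + H + K))
  translate {a} {a*} {b} {b*} {c} S H K = record
    { shift-a = λ x y e → subst (λ z → Shift (b (y + K)) (a (x + H)) (a* z)) (move x y H K)
        (shift-a (x + H) (y + K) (trans e (cong c (merge x y H K))))
    ; shift-b = λ x y e → subst (λ z → Shift (a (x + H)) (b (y + K)) (b* z)) (move y x K H)
        (shift-b (x + H) (y + K) (trans e (cong c (merge x y H K))))
    ; sum = λ x y → subst (λ z → Sum (a (x + H)) (b (y + K)) (c z)) (sym (merge x y H K)) (sum (x + H) (y + K)) }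
    where
    open System S
    merge : ∀ x y H K → x + y + H + K ≡ (x + H) + (y + K)
    merge = solve-∀
    move : ∀ x y H K → (x + H) + (y + K) * + 8 ≡ x + y * + 8 + H + K * + 8
    move = solve-∀

  contract : ∀ {a a* b b* c} → System a a* b b* c →
    System (λ x → a (x * + 8)) (λ x → a* (x * + 8)) (λ y → b (y * + 8)) (λ y → b* (y * + 8)) (λ z → c (z * + 8))
  contract {a} {a*} {b} {b*} {c} S = record
    { shift-a = λ x y e → subst (λ z → Shift (b (y * + 8)) (a (x * + 8)) (a* z)) (move x y)
        (shift-a (x * + 8) (y * + 8) (trans e (cong c (ℤ.*-distribʳ-+ (+ 8) x y))))
    ; shift-b = λ x y e → subst (λ z → Shift (a (x * + 8)) (b (y * + 8)) (b* z)) (move y x)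
        (shift-b (x * + 8) (y * + 8) (trans e (cong c (ℤ.*-distribʳ-+ (+ 8) x y))))
    ; sum = λ x y → subst (λ z → Sum (a (x * + 8)) (b (y * + 8)) (c z)) (sym (ℤ.*-distribʳ-+ (+ 8) x y)) (sum (x * + 8) (y * + 8)) }
    where
    open System S
    move : ∀ x y → x * + 8 + (y * + 8) * + 8 ≡ (x + y * + 8) * + 8
    move = solve-∀

  module Level {a a* b b* c} (S : System a a* b b* c) (Na : Normal a) (Nb : Normal b) (Nc : Normal c) where
    open System S

    -- At x = 8 m and y = k with ρ k nonzero, normality gives b y = ρ k = c (x + y). The premise of
    -- `shift-a` therefore holds, and its conclusion reads a* at 8 (m + k), as `Rigid` requires.
    offset-a : ∃ λ H → ∀ m → ρ (m - H) ≢ 0F → a (m * + 8) ≡ ρ (m - H)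
    offset-a = Rigid.offset (λ m → a (m * + 8)) (λ m → a* (m * + 8)) λ m k n →
      subst₂ (λ d z → Shift d (a (m * + 8)) (a* z)) (Nb k n) (sym (ℤ.*-distribʳ-+ (+ 8) m k))
        (shift-a (m * + 8) k (trans (Nb k n) (sym (normal-≡ Nc (m * + 8 + k) (drop m k) n))))

    offset-b : ∃ λ K → ∀ m → ρ (m - K) ≢ 0F → b (m * + 8) ≡ ρ (m - K)
    offset-b = Rigid.offset (λ m → b (m * + 8)) (λ m → b* (m * + 8)) λ m k n →
      subst₂ (λ d z → Shift d (b (m * + 8)) (b* z)) (Na k n) (sym (ℤ.*-distribʳ-+ (+ 8) m k))
        (shift-b k (m * + 8) (trans (Na k n) (sym (normal-≡ Nc (k + m * + 8) (drop′ k m) n))))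

    H K : ℤ
    H = proj₁ offset-a
    K = proj₁ offset-b

    a′ b′ c′ : ℤ → Fin 8
    a′ x = a ((x + H) * + 8)
    b′ y = b ((y + K) * + 8)
    c′ z = c ((z + H + K) * + 8)

    next : System a′ (λ x → a* ((x + H + K * + 8) * + 8)) b′ (λ y → b* ((y + K + H * + 8) * + 8)) c′
    next = translate (contract S) H K

    private
      cancel : ∀ x H → x + H - H ≡ x
      cancel = solve-∀

    Na′ : Normal a′
    Na′ x n = trans (proj₂ offset-a (x + H) (λ e → n (trans (cong ρ (sym (cancel x H))) e))) (cong ρ (cancel x H))

    Nb′ : Normal b′
    Nb′ x n = trans (proj₂ offset-b (x + K) (λ e → n (trans (cong ρ (sym (cancel x K))) e))) (cong ρ (cancel x K))

    private
      restore : ∀ x z → x + (z - x) ≡ z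
      restore = solve-∀

      sum-at : ∀ z x → ρ x ≢ 0F → ρ z -₈ ρ x ≢ 0F → Sum (ρ x) (ρ z -₈ ρ x) (c′ z)
      sum-at z x n n′ = subst₂ (λ u v → Sum u v (c′ z)) (Na′ x n) (normal-≡ Nb′ (z - x) (minus z x) n′)
        (subst (λ w → Sum (a′ x) (b′ (z - x)) (c′ w)) (restore x z) (System.sum next x (z - x)))

    -- There is no shift rule for c. Its value at z is determined by the sum rule over all ways of
    -- writing z as x + (z - x) with nonzero residues.
    Nc′ : Normal c′
    Nc′ z n = sum-unique (ρ z) (c′ z) n λ d d≢0 e≢0 → let x , q = onto d in
      subst (λ d → Sum d (ρ z -₈ d) (c′ z)) q (sum-at z x (λ e → d≢0 (trans (sym q) e)) (λ e → e≢0 (trans (cong (ρ z -₈_) (sym q)) e)))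

  -- At an x where neither ρ x nor ρ (x + p) is 0, both values of a are residues, and the period
  -- equates them.
  period-multiple : ∀ {a} → Normal a → ∀ p → (∀ x → a (x + p) ≡ a x) → ρ p ≡ 0F
  period-multiple {a} N p periodic with avoiding 0F (0F -₈ ρ p) 0F 0F
  ... | x , n₁ , n₂ , _ = +₈-cancelˡ (ρ x) (ρ p) (trans (sym (normal-≡ N (x + p) (hom x p) λ e → n₂ (trans (sym (+₈-₈ (ρ x) (ρ p))) (cong (_-₈ ρ p) e))))
      (trans (periodic x) (N x n₁)))

  -- The number n bounds the descent. A period p + 1 is 8 (q + 1), and on the next level a′ has the
  -- smaller period q + 1.
  aperiodic : ∀ n {a a* b b* c} → System a a* b b* c → Normal a → Normal b → Normal c →
    ∀ p → p ℕ.≤ n → ¬ (∀ x → a (x + + ℕ.suc p) ≡ a x)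
  aperiodic n S Na Nb Nc p le periodic with kernel (+ ℕ.suc p) (period-multiple Na (+ ℕ.suc p) periodic)
  ... | + ℕ.zero , ()
  ... | -[1+ _ ] , ()
  aperiodic ℕ.zero S Na Nb Nc ℕ.zero le periodic | + ℕ.suc q , ()
  aperiodic (ℕ.suc n) {a} S Na Nb Nc p le periodic | + ℕ.suc q , e =
    aperiodic n next Na′ Nb′ Nc′ q (ℕ.s≤s⁻¹ (ℕ.≤-trans (smaller (ℤ.+-injective (trans e (sym (ℤ.pos-* (ℕ.suc q) 8))))) le))
      λ x → trans (cong a (trans (expand x H (+ ℕ.suc q)) (cong (λ z → (x + H) * + 8 + z) (sym e)))) (periodic ((x + H) * + 8))
    where
    open Level S Na Nb Nc
    expand : ∀ x H q → (x + q + H) * + 8 ≡ (x + H) * + 8 + q * + 8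
    expand = solve-∀
    smaller : ℕ.suc p ≡ ℕ.suc q ℕ.* 8 → ℕ.suc q ℕ.≤ p
    smaller eq = ℕ.s≤s⁻¹ (ℕ.≤-trans (ℕ.m<m*n (ℕ.suc q) 8 (ℕ.s≤s (ℕ.s≤s ℕ.z≤n))) (ℕ.≤-reflexive (sym eq)))

-- Periods

module _ (G₁ : FiniteAbelianGroup) where
  open Ambient G₁
  private module H = Laws G₁

  multiple-of-e₁ : ℕ → G
  multiple-of-e₁ n = (+ n , + 0 , H.ε)

  private
    difference : ∀ m n r → (multiple-of-e₁ (m ℕ.+ n) ⊖ r) ⊖ (multiple-of-e₁ m ⊖ r) ≡ multiple-of-e₁ n
    difference m n (a , b , x) = cong₂ _,_ (trans (cong (λ z → z - a - (+ m - a)) (ℤ.pos-+ m n)) (first (+ m) (+ n) a))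
      (cong₂ _,_ (second b) (H.∙-inverseʳ (H.ε H.∙ (x H.⁻¹))))
      where
      first : ∀ m n a → m + n - a - (m - a) ≡ n
      first = solve-∀
      second : ∀ b → + 0 - b - (+ 0 - b) ≡ + 0
      second = solve-∀

    exchange : ∀ g h c → (g ⊖ c) ⊕ h ≡ (g ⊕ h) ⊖ c
    exchange (a , b , x) (a′ , b′ , y) (a″ , b″ , z) = cong₂ _,_ (swap a a′ a″) (cong₂ _,_ (swap b b′ b″)
      (trans (H.∙-assoc x (z H.⁻¹) y) (trans (cong (x H.∙_) (H.∙-comm (z H.⁻¹) y)) (sym (H.∙-assoc x y (z H.⁻¹))))))
      where
      swap : ∀ a h c → a - c + h ≡ a + h - c
      swap = solve-∀

  -- Among one more multiples of e₁ than there are coset representatives, two lie in the same coset.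
  -- Their difference lies in the subgroup, and a union of its cosets is stable under it.
  Periodic⇒period : ∀ A → Periodic A → ∃ λ n → ∀ g → A g → A (g ⊕ multiple-of-e₁ (ℕ.suc n))
  Periodic⇒period A (Q , subgroup , (reps , cover) , cs , cosets) = n , λ g Ag →
    let c , c∈ , Qgc = proj₁ (cosets g) Ag
    in proj₂ (cosets (g ⊕ multiple-of-e₁ (ℕ.suc n))) c c∈ (subst Q (exchange g (multiple-of-e₁ (ℕ.suc n)) c) (⊕-mem Qgc Qn))
    where
    open Subgroup subgroup
    coset : ∀ (i : Fin (ℕ.suc (length reps))) → ∃ λ r → r ∈ reps × Q (multiple-of-e₁ (toℕ i) ⊖ r)
    coset i = cover (multiple-of-e₁ (toℕ i))
    collision = pigeonhole (ℕ.n<1+n (length reps)) (λ i → index (proj₁ (proj₂ (coset i))))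
    i j : Fin (ℕ.suc (length reps))
    i = proj₁ collision
    j = proj₁ (proj₂ collision)
    same : proj₁ (coset j) ≡ proj₁ (coset i)
    same = trans (lookup-index (proj₁ (proj₂ (coset j)))) (trans (cong (List.lookup reps) (sym (proj₂ (proj₂ (proj₂ collision)))))
      (sym (lookup-index (proj₁ (proj₂ (coset i))))))
    gap = ℕ.m≤n⇒∃[o]m+o≡n (proj₁ (proj₂ (proj₂ collision)))
    n = proj₁ gap
    j≡ : toℕ j ≡ toℕ i ℕ.+ ℕ.suc n
    j≡ = trans (sym (proj₂ gap)) (sym (ℕ.+-suc (toℕ i) n))
    Qn : Q (multiple-of-e₁ (ℕ.suc n))
    Qn = subst Q (difference (toℕ i) (ℕ.suc n) (proj₁ (coset i)))
      (⊕-mem (subst₂ (λ m r → Q (multiple-of-e₁ m ⊖ r)) j≡ same (proj₂ (proj₂ (coset j)))) (⊝-mem (proj₂ (proj₂ (coset i)))))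

-- Letters in binary

letter : Bool → Bool → Bool → Fin 8
letter false false false = 0F
letter true  false false = 1F
letter false true  false = 2F
letter true  true  false = 3F
letter false false true  = 4F
letter true  false true  = 5F
letter false true  true  = 6F
letter true  true  true  = 7F

bit : Fin 8 → Fin 3 → Bool
bit d 0F = odd d
bit 0F 1F = false
bit 1F 1F = false
bit 2F 1F = true
bit 3F 1F = true
bit 4F 1F = false
bit 5F 1F = false
bit 6F 1F = true
bit 7F 1F = true
bit 0F 2F = false
bit 1F 2F = false
bit 2F 2F = false
bit 3F 2F = false
bit 4F 2F = true
bit 5F 2F = true
bit 6F 2F = true
bit 7F 2F = true

letter-bit : ∀ d → letter (bit d 0F) (bit d 1F) (bit d 2F) ≡ d
letter-bit = from-yes (all? λ d → letter (bit d 0F) (bit d 1F) (bit d 2F) Fin.≟ d)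

odd-letter : ∀ p q r → odd (letter p q r) ≡ p
odd-letter = from-yes (allᵇ? λ p → allᵇ? λ q → allᵇ? λ r → odd (letter p q r) ≟ᵇ p)

position : Fin 8 → Fin 3 → Fin 24
position = combine

letterAt : (Fin 24 → Bool) → Fin 8 → Fin 8
letterAt β j = letter (β (position j 0F)) (β (position j 1F)) (β (position j 2F))

letters : (Fin 24 → Bool) → Vec (Fin 8) 8
letters β = tabulate (letterAt β)

letter-cong : ∀ {p p′ q q′ r r′} → p ≡ p′ → q ≡ q′ → r ≡ r′ → letter p q r ≡ letter p′ q′ r′
letter-cong refl refl refl = refl

letters-cong : ∀ {β γ} → (∀ i → β i ≡ γ i) → letters β ≡ letters γ
letters-cong eq = tabulate-cong λ j → letter-cong (eq (position j 0F)) (eq (position j 1F)) (eq (position j 2F))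

-- The same-site rule.  The letters are the values of a (x), a* (x + 8 y), b (y), b* (y + 8 x),
-- c (x + y) and of the references r (x), s (y), t (x + y), which supply the residues modulo 8.
Rule : Vec (Fin 8) 8 → Set
Rule (a ∷ a* ∷ b ∷ b* ∷ c ∷ r ∷ s ∷ t ∷ []) =
  t ≡ r +₈ s × (r ≡ 0F ⊎ a ≡ r) × (s ≡ 0F ⊎ b ≡ s) × (t ≡ 0F ⊎ c ≡ t) ×
  (b ≡ c → Shift b a a*) × (a ≡ c → Shift a b b*) × Sum a b c

Rule? : ∀ v → Dec (Rule v)
Rule? (a ∷ a* ∷ b ∷ b* ∷ c ∷ r ∷ s ∷ t ∷ []) =
  t Fin.≟ r +₈ s ×-dec (r Fin.≟ 0F ⊎-dec a Fin.≟ r) ×-dec (s Fin.≟ 0F ⊎-dec b Fin.≟ s) ×-dec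
  (t Fin.≟ 0F ⊎-dec c Fin.≟ t) ×-dec
  (b Fin.≟ c →-dec Shift? b a a*) ×-dec (a Fin.≟ c →-dec Shift? a b b*) ×-dec Sum? a b c

vectors : ∀ n → List (Vec Bool n)
vectors ℕ.zero    = [] ∷ []
vectors (ℕ.suc n) = List.map (false ∷_) (vectors n) ++ List.map (true ∷_) (vectors n)

∈-vectors : ∀ {n} (v : Vec Bool n) → v ∈ vectors n
∈-vectors []          = here refl
∈-vectors (false ∷ v) = ∈-++⁺ˡ (∈-map⁺ (false ∷_) (∈-vectors v))
∈-vectors {ℕ.suc n} (true ∷ v) = ∈-++⁺ʳ (List.map (false ∷_) (vectors n)) (∈-map⁺ (true ∷_) (∈-vectors v))

Forbidden? : ∀ (v : Vec Bool 24) → Dec (¬ Rule (letters (lookup v)))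
Forbidden? v = ¬? (Rule? (letters (lookup v)))

opaque
  -- A pattern prescribes all 24 bits at a site, so every same-site rule is the list of its
  -- violations. Being opaque, the list is not unfolded outside this block, which avoids running
  -- through 2^24 vectors.
  forbiddenVectors : List (Vec Bool 24)
  forbiddenVectors = filter Forbidden? (vectors 24)

  forbiddenVectors-sound : ∀ c → ¬ Rule (letters (lookup (List.lookup forbiddenVectors c)))
  forbiddenVectors-sound c = proj₂ (∈-filter⁻ Forbidden? {xs = vectors 24} (∈-lookup c))

  forbiddenVectors-complete : ∀ v → ¬ Rule (letters (lookup v)) → v ∈ forbiddenVectors
  forbiddenVectors-complete v n = ∈-filter⁺ Forbidden? (∈-vectors v) n

-- A vector on which the linear form read by the letter vanishes: (8 , -1) for x + 8 y, (1 , -8) for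
-- y + 8 x, (1 , -1) for x + y.
axis : Fin 8 → ℤ × ℤ
axis 0F = + 0 , + 1
axis 1F = + 8 , -[1+ 0 ]
axis 2F = + 1 , + 0
axis 3F = + 1 , -[1+ 7 ]
axis 4F = + 1 , -[1+ 0 ]
axis 5F = + 0 , + 1
axis 6F = + 1 , + 0
axis 7F = + 1 , -[1+ 0 ]

-- The lowest bit of the reference r changes at every step of x, which excludes constant solutions.
phase : Fin 8 → Fin 3 → List (ℤ × ℤ × Bool)
phase j q with j Fin.≟ 5F | q Fin.≟ 0F
... | yes _ | yes _ = (+ 1 , + 0 , true) ∷ []
... | _     | _     = []

directions : Fin 8 × Fin 3 → List (ℤ × ℤ × Bool)
directions (j , q) = (proj₁ (axis j) , proj₂ (axis j) , false) ∷ phase j q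

module Digits = Patterns 24 (length forbiddenVectors) (λ i → directions (remQuot {8} 3 i))
  (λ c → lookup (List.lookup forbiddenVectors c))

-- The solution given by last nonzero digits

solution : Fin 8 → ℤ → ℤ → Fin 8
solution 0F x y = digit x
solution 1F x y = digit (x + y * + 8)
solution 2F x y = digit y
solution 3F x y = digit (y + x * + 8)
solution 4F x y = digit (x + y)
solution 5F x y = res x
solution 6F x y = res y
solution 7F x y = res (x + y)

solutionBit : Fin 24 → ℤ → ℤ → Bool
solutionBit i x y = let j , q = remQuot {8} 3 i in bit (solution j x y) q

solution-letters : ∀ x y → letters (λ i → solutionBit i x y) ≡ tabulate (λ j → solution j x y)
solution-letters x y = tabulate-cong λ j → trans
  (letter-cong (at j 0F) (at j 1F) (at j 2F)) (letter-bit (solution j x y))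
  where
  at : ∀ j q → solutionBit (position j q) x y ≡ bit (solution j x y) q
  at j q = cong (λ p → bit (solution (proj₁ p) x y) (proj₂ p)) (remQuot-combine {8} {3} j q)

solution-rule : ∀ x y → Rule (tabulate (λ j → solution j x y))
solution-rule x y = hom x y , known x , known y , known (x + y) ,
  digit-shift x y , (λ e → digit-shift y x (trans e (cong digit (ℤ.+-comm x y)))) , digit-sum x y
  where
  open Residue res-residue
  known : ∀ z → res z ≡ 0F ⊎ digit z ≡ res z
  known z with res z Fin.≟ 0F
  ... | yes p = inj₁ p
  ... | no n  = inj₂ (digit-res z n)

solution-directional : ∀ j q → All (λ { (v , w , ε) → ∀ a b → bit (solution j (a - v) (b - w)) q ≡ bit (solution j a b) q xor ε }) (directions (j , q))
solution-directional j q = (λ a b → trans (cong (λ d → bit d q) (invariant j a b)) (sym (xor-identityʳ _))) ∷ phases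
  where
  invariant : ∀ j a b → solution j (a - proj₁ (axis j)) (b - proj₂ (axis j)) ≡ solution j a b
  invariant 0F a b = cong digit (ℤ.+-identityʳ a)
  invariant 1F a b = cong digit (cancel a b)
    where
    cancel : ∀ a b → a - + 8 + (b - - + 1) * + 8 ≡ a + b * + 8
    cancel = solve-∀
  invariant 2F a b = cong digit (ℤ.+-identityʳ b)
  invariant 3F a b = cong digit (cancel a b)
    where
    cancel : ∀ a b → b - - + 8 + (a - + 1) * + 8 ≡ b + a * + 8
    cancel = solve-∀
  invariant 4F a b = cong digit (cancel a b)
    where
    cancel : ∀ a b → a - + 1 + (b - - + 1) ≡ a + b
    cancel = solve-∀
  invariant 5F a b = cong res (ℤ.+-identityʳ a)
  invariant 6F a b = cong res (ℤ.+-identityʳ b)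
  invariant 7F a b = cong res (cancel a b)
    where
    cancel : ∀ a b → a - + 1 + (b - - + 1) ≡ a + b
    cancel = solve-∀
  restore : ∀ a → a - + 1 + + 1 ≡ a
  restore = solve-∀
  phases : All (λ { (v , w , ε) → ∀ a b → bit (solution j (a - v) (b - w)) q ≡ bit (solution j a b) q xor ε }) (phase j q)
  phases with j Fin.≟ 5F | q Fin.≟ 0F
  ... | yes refl | yes refl = (λ a b → trans (sym (Bool.not-involutive _)) (trans (cong not (trans (sym (odd-+₈-1 (res (a - + 1))))
          (cong odd (trans (cong (res (a - + 1) +₈_) (sym res-1)) (trans (sym (Residue.hom res-residue (a - + 1) (+ 1))) (cong res (restore a)))))))
          (xor-comm true (odd (res a))))) ∷ []
  ... | yes refl | no _  = []
  ... | no _     | yes _ = []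
  ... | no _     | no _  = []

solution-valid : Digits.Valid solutionBit
solution-valid = record
  { directional = λ i → let j , q = remQuot {8} 3 i in solution-directional j q
  ; avoids = λ c x y → avoid c x y (any? λ i → ¬? (solutionBit i x y Bool.≟ lookup (List.lookup forbiddenVectors c) i)) }
  where
  avoid : ∀ c x y → Dec (∃ λ i → solutionBit i x y ≢ lookup (List.lookup forbiddenVectors c) i) →
    ∃ λ i → solutionBit i x y ≢ lookup (List.lookup forbiddenVectors c) i
  avoid c x y (yes p) = p
  avoid c x y (no n)  = ⊥-elim (forbiddenVectors-sound c (subst Rule
    (trans (sym (solution-letters x y)) (letters-cong λ i → decidable-stable (_ Bool.≟ _) (λ d → n (i , d))))
    (solution-rule x y)))

-- Every solution is aperiodic

module Decode (g : Fin 24 → ℤ → ℤ → Bool) (valid : Digits.Valid g) where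
  open Digits.Valid valid

  L : Fin 8 → ℤ → ℤ → Fin 8
  L j x y = letterAt (λ i → g i x y) j

  rule : ∀ x y → Rule (letters (λ i → g i x y))
  rule x y = decidable-stable (Rule? (letters (λ i → g i x y))) λ n →
    let v = tabulate (λ i → g i x y)
        m = forbiddenVectors-complete v (λ r → n (subst Rule (letters-cong (lookup∘tabulate (λ i → g i x y))) r))
        i , differs = avoids (index m) x y
    in differs (trans (sym (lookup∘tabulate (λ i → g i x y) i)) (cong (λ v → lookup v i) (lookup-index m)))

  Along : Fin 8 → Fin 3 → ℤ × ℤ × Bool → Set
  Along j q (v , w , ε) = ∀ x y → g (position j q) (x - v) (y - w) ≡ g (position j q) x y xor ε

  along : ∀ j q → All (Along j q) (directions (j , q))
  along j q = subst (λ p → All (Along j q) (directions p)) (remQuot-combine {8} {3} j q) (All.map (λ H → H) (directional (position j q)))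

  L-invariant : ∀ j x y → L j (x - proj₁ (axis j)) (y - proj₂ (axis j)) ≡ L j x y
  L-invariant j x y = letter-cong (bit-invariant 0F) (bit-invariant 1F) (bit-invariant 2F)
    where
    bit-invariant : ∀ q → g (position j q) (x - proj₁ (axis j)) (y - proj₂ (axis j)) ≡ g (position j q) x y
    bit-invariant q = trans (All.head (along j q) x y) (xor-identityʳ _)

  slide : ∀ j m x y → L j (x + m * proj₁ (axis j)) (y + m * proj₂ (axis j)) ≡ L j x y
  slide j m x y = trans (ℤ-constant (λ m → L j (x + m * v) (y + m * w)) step m) (cong₂ (L j) (start x v) (start y w))
    where
    v w : ℤ
    v = proj₁ (axis j)
    w = proj₂ (axis j)
    start : ∀ x v → x + + 0 * v ≡ x
    start = solve-∀
    back : ∀ x m v → x + (m - + 1) * v ≡ x + m * v - v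
    back = solve-∀
    step : ∀ m → L j (x + (m - + 1) * v) (y + (m - + 1) * w) ≡ L j (x + m * v) (y + m * w)
    step m = trans (cong₂ (L j) (back x m v) (back y m w)) (L-invariant j (x + m * v) (y + m * w))

  slideTo : ∀ j m x y {x′ y′} → x + m * proj₁ (axis j) ≡ x′ → y + m * proj₂ (axis j) ≡ y′ → L j x y ≡ L j x′ y′
  slideTo j m x y refl refl = sym (slide j m x y)

  a a* b b* c r s t : ℤ → Fin 8
  a  x = L 0F x (+ 0)
  a* x = L 1F x (+ 0)
  b  y = L 2F (+ 0) y
  b* y = L 3F (+ 0) y
  c  x = L 4F x (+ 0)
  r  x = L 5F x (+ 0)
  s  y = L 6F (+ 0) y
  t  x = L 7F x (+ 0)

  private
    keep : ∀ x m → x + m * + 0 ≡ x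
    keep = solve-∀
    clear : ∀ y → y + (- y) * + 1 ≡ + 0
    clear = solve-∀
    cancel : ∀ y → y + y * -[1+ 0 ] ≡ + 0
    cancel = solve-∀
    plus : ∀ x y → x + y * + 1 ≡ x + y
    plus = solve-∀
    plus-8 : ∀ y x → y + (- x) * -[1+ 7 ] ≡ y + x * + 8
    plus-8 = solve-∀

  L-a : ∀ x y → L 0F x y ≡ a x
  L-a x y = slideTo 0F (- y) x y (keep x (- y)) (clear y)

  L-a* : ∀ x y → L 1F x y ≡ a* (x + y * + 8)
  L-a* x y = slideTo 1F y x y refl (cancel y)

  L-b : ∀ x y → L 2F x y ≡ b y
  L-b x y = slideTo 2F (- x) x y (clear x) (keep y (- x))

  L-b* : ∀ x y → L 3F x y ≡ b* (y + x * + 8)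
  L-b* x y = slideTo 3F (- x) x y (clear x) (plus-8 y x)

  L-c : ∀ x y → L 4F x y ≡ c (x + y)
  L-c x y = slideTo 4F y x y (plus x y) (cancel y)

  L-r : ∀ x y → L 5F x y ≡ r x
  L-r x y = slideTo 5F (- y) x y (keep x (- y)) (clear y)

  L-s : ∀ x y → L 6F x y ≡ s y
  L-s x y = slideTo 6F (- x) x y (clear x) (keep y (- x))

  L-t : ∀ x y → L 7F x y ≡ t (x + y)
  L-t x y = slideTo 7F y x y (plus x y) (cancel y)

  rule′ : ∀ x y → Rule (a x ∷ a* (x + y * + 8) ∷ b y ∷ b* (y + x * + 8) ∷ c (x + y) ∷ r x ∷ s y ∷ t (x + y) ∷ [])
  rule′ x y = subst Rule (∷-cong (L-a x y) (∷-cong (L-a* x y) (∷-cong (L-b x y) (∷-cong (L-b* x y)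
    (∷-cong (L-c x y) (∷-cong (L-r x y) (∷-cong (L-s x y) (∷-cong (L-t x y) refl)))))))) (rule x y)
    where
    ∷-cong : ∀ {n d e} {v w : Vec (Fin 8) n} → d ≡ e → v ≡ w → d ∷ v ≡ e ∷ w
    ∷-cong refl refl = refl

  r-parity : ∀ x → odd (r (x - + 1)) ≡ not (odd (r x))
  r-parity x = trans (odd-letter _ _ _) (trans (All.head (All.tail (along 5F 0F)) x (+ 0))
    (trans (xor-comm _ true) (cong not (sym (odd-letter _ _ _)))))

  ρ : ℤ → Fin 8
  ρ x = r x -₈ r (+ 0)

  private
    t≡ : ∀ x y → t (x + y) ≡ r x +₈ s y
    t≡ x y = proj₁ (rule′ x y)

    r-additive : ∀ x y → r (x + y) ≡ (r x +₈ s y) -₈ s (+ 0)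
    r-additive x y = trans (sym (+₈-₈ _ _)) (cong (_-₈ s (+ 0)) (trans (sym (t≡ (x + y) (+ 0))) (trans (cong t (ℤ.+-identityʳ (x + y))) (t≡ x y))))

    s≡ : ∀ y → s y ≡ (r y +₈ s (+ 0)) -₈ r (+ 0)
    s≡ y = trans (sym (+₈-₈ (s y) (r (+ 0)))) (cong (_-₈ r (+ 0)) (trans (+₈-comm (s y) (r (+ 0)))
      (trans (sym (t≡ (+ 0) y)) (trans (cong t (ℤ.+-comm (+ 0) y)) (t≡ y (+ 0))))))

  -- The rule t (x + y) = r x + s y at all sites makes r affine, so ρ is additive. The parity of r
  -- alternates, so the slope of ρ is odd.
  residue : Residue ρ
  residue = odd-residue ρ
    (λ x y → trans (cong (_-₈ r (+ 0)) (trans (r-additive x y) (cong (λ d → (r x +₈ d) -₈ s (+ 0)) (s≡ y))))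
      (+₈-difference (r x) (r y) (s (+ 0)) (r (+ 0))))
    (odd-difference (r (+ 1)) (r (+ 0)) (r-parity (+ 1)))

  open Residue residue using (hom; onto)
  open Descent ρ residue

  private
    -- These offsets move r and s to where they vanish at the origin, so that after translation all
    -- three references equal ρ.
    H K : ℤ
    H = proj₁ (onto (0F -₈ r (+ 0)))
    K = proj₁ (onto (0F -₈ s (+ 0)))

    r-shift : ∀ x → r (x + H) ≡ ρ x
    r-shift x = trans (sym (-₈-+₈ (r (x + H)) (r (+ 0)))) (trans (cong (_+₈ r (+ 0))
      (trans (hom x H) (cong (ρ x +₈_) (proj₂ (onto (0F -₈ r (+ 0))))))) (+₈-shift (ρ x) (r (+ 0))))

    s-shift : ∀ y → s (y + K) ≡ ρ y
    s-shift y = trans (s≡ (y + K)) (trans (+₈-exchange (r (y + K)) (s (+ 0)) (r (+ 0))) (trans (cong (_+₈ s (+ 0))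
      (trans (hom y K) (cong (ρ y +₈_) (proj₂ (onto (0F -₈ s (+ 0))))))) (+₈-shift (ρ y) (s (+ 0)))))

    t-shift : ∀ z → t (z + H + K) ≡ ρ z
    t-shift z = trans (t≡ (z + H) K) (trans (cong₂ _+₈_ (r-shift z) (trans (cong s (sym (ℤ.+-identityˡ K))) (trans (s-shift (+ 0)) (-₈-self (r (+ 0))))))
      (+₈-identityʳ (ρ z)))

    system : System a a* b b* c
    system = record
      { shift-a = λ x y → let _ , _ , _ , _ , p , _ = rule′ x y in p
      ; shift-b = λ x y → let _ , _ , _ , _ , _ , p , _ = rule′ x y in p
      ; sum     = λ x y → let _ , _ , _ , _ , _ , _ , p = rule′ x y in p }

    determined : ∀ {d e f : Fin 8} → e ≡ f → e ≡ 0F ⊎ d ≡ e → f ≢ 0F → d ≡ f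
    determined refl (inj₁ p) n = ⊥-elim (n p)
    determined refl (inj₂ p) n = p

  -- A horizontal period suffices for a contradiction, because a is read along x. At the top level
  -- normality is the part of the rule that compares a, b, c with the references.
  no-period : ∀ n → ¬ (∀ i x y → g i (x + + ℕ.suc n) y ≡ g i x y)
  no-period n periodic = aperiodic n (translate system H K)
    (λ x → determined (r-shift x) (let _ , p , _ = rule′ (x + H) (+ 0) in p))
    (λ y → determined (s-shift y) (let _ , _ , p , _ = rule′ (+ 0) (y + K) in p))
    (λ z → determined (t-shift z) (let _ , _ , _ , p , _ = rule′ (z + H) K in p))
    n ℕ.≤-refl
    (λ x → trans (cong a (reorder x (+ ℕ.suc n) H))
      (letter-cong (periodic (position 0F 0F) (x + H) (+ 0)) (periodic (position 0F 1F) (x + H) (+ 0)) (periodic (position 0F 2F) (x + H) (+ 0))))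
    where
    reorder : ∀ x p H → x + p + H ≡ x + H + p
    reorder = solve-∀

module _ where
  open Digits

  solution-tiling : All (Tiles (graph (Build.f (Complete.x solutionBit solution-valid)))) tiles
  solution-tiling = Complete.tiling solutionBit solution-valid

  tiling-aperiodic : ∀ A → All (Tiles A) tiles → ¬ Periodic A
  tiling-aperiodic A (A-whole ∷ A-constraints) periodic =
    let n , shift = Periodic⇒period Gᴿ A periodic
    in Decode.no-period S.g S.valid n (S.translation-invariant (+ ℕ.suc n) λ X y Ay →
      subst A (cong₂ pt refl (trans (Laws.∙-comm R y _) (Laws.∙-identityˡ R y))) (shift (pt X y) Ay))
    where
    module S = Sound A A-whole (map⁻ A-constraints)

theorem3p3 : Σ FiniteAbelianGroup λ G₁ → Σ ℕ λ M → M ≥ 1 ×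
    Σ (Fin M → List (Ambient.G G₁)) λ F →
    ((m : Fin M) → Ambient.NonEmpty G₁ (F m)) × Ambient.Aperiodic G₁ M F
theorem3p3 = Digits.Gᴿ , length Digits.tiles , ℕ.s≤s ℕ.z≤n , List.lookup Digits.tiles ,
  (λ m → All.lookup Digits.tiles-nonempty (∈-lookup m)) ,
  (_ , λ m → All.lookup solution-tiling (∈-lookup m)) ,
  λ A A-tiles → tiling-aperiodic A (lookup-All Digits.tiles A-tiles)
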